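{- Let $\mathcal{F}$ be a periodic tame frieze with minimal period $n$, let $(m_{i,j})_{i,j\in\mathbb{Z}}$ be its lattice, and let $(s_k)_{k\ge0}$ be its growth coefficients, $s_0:=2$ and $s_k:=m_{1,kn}-m_{2,kn-1}$ for $k\ge1$. Then (a) $s_{k+2}=s_1s_{k+1}-s_k$ for all $k\ge 0$; (b) for all $k\ge1$, $$s_k=s_1^k+k\sum_{l=1}^{\lfloor k/2\rfloor}(-1)^l\,\frac{1}{k-l}\binom{k-l}{l}\,s_1^{k-2l}.$$
   Context: A frieze is an array $\mathcal{F}=(m_{i,j})$ of real numbers, with $i\in\mathbb{Z}$, whose rows are the sets of positions with $j-i$ constant, such that $m_{i,i-2}=0$ and $m_{i,i-1}=1$ for all $i$, and such that $m_{i,j}m_{i+1,j+1}-m_{i,j+1}m_{i+1,j}=1$ whenever all four entries lie in the array. It is infinite if it is indexed by all $(i,j)$ with $j-i\ge -2$; it is finite if it is indexed by all $(i,j)$ with $-2\le j-i\le N-2$ for some integer $N\ge 3$ and ends with a row of ones followed by a row of zeros: $m_{i,i+N-3}=1$ and $m_{i,i+N-2}=0$ for all $i$. The frieze is tame if every $3\times 3$ matrix $\begin{pmatrix} m_{i,j}&m_{i+1,j}&m_{i+2,j}\\ m_{i,j+1}&m_{i+1,j+1}&m_{i+2,j+1}\\ m_{i,j+2}&m_{i+1,j+2}&m_{i+2,j+2}\end{pmatrix}$ of entries of the array has determinant $0$. It is $n$-periodic ($n\ge1$) if $m_{i+n,j+n}=m_{i,j}$ for all entries, and periodic if it is $n$-periodic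 for some $n\geq 1$; the minimal period is the least such $n$. The lattice $(m_{i,j})_{i,j\in\mathbb{Z}}$ of $\mathcal{F}$ is the extension of $\mathcal{F}$ to all of $\mathbb{Z}^2$ by anti-symmetric mirroring across rows of zeros: if $\mathcal{F}$ is infinite, $m_{i,j}=-m_{j+2,i-2}$ for $j-i<-2$; if $\mathcal{F}$ is finite, the lattice is the unique extension satisfying $m_{i,j}=-m_{j+2,i-2}$ and $m_{i,j}=-m_{j-N+2,i+N-2}$ for all $i,j\in\mathbb{Z}$. -}

module Defs where

open import Algebra.Bundles using (CommutativeRing)
import Algebra.Properties.CommutativeMonoid.Sum
import Algebra.Properties.Semiring.Exp
open import Data.Fin.Base using (Fin; toℕ)
open import Data.Fin.Patterns using (0F; 1F; 2F)
open import Data.Fin.Properties using (toℕ<n)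
open import Data.Integer.Base as ℤ using (ℤ; +_)
open import Data.Nat.Base as ℕ using (ℕ; zero; suc; ⌊_/2⌋)
import Data.Nat.Properties as ℕₚ
open import Data.Product.Base using (_×_; _,_; ∃-syntax)
open import Data.Rational.Base as ℚ using (ℚ; 0ℚ; 1ℚ; ½; ∣_∣)
import Data.Rational.Properties as ℚₚ
open import Data.Rational.Solver using (module +-*-Solver)
open import Data.Unit.Base using (⊤)
open import Level using (0ℓ)
open import Relation.Binary.PropositionalEquality
  using (_≡_; refl; sym; trans; cong; cong₂; subst)

IsCauchy : (ℕ → ℚ) → Set
IsCauchy x = ∀ ε → 0ℚ ℚ.< ε →
  ∃[ N ] (∀ m n → N ℕ.≤ m → N ℕ.≤ n → ∣ x m ℚ.- x n ∣ ℚ.< ε)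

-- ℝ is the set of rational Cauchy sequences modulo null sequences; since there
-- are no quotient types, _≃_ below plays the role of equality of real numbers.
record ℝ : Set where
  no-eta-equality
  field
    seq    : ℕ → ℚ
    cauchy : IsCauchy seq
open ℝ public

infix 4 _≃_

record _≃_ (x y : ℝ) : Set where
  constructor mk≃
  field
    converge : ∀ ε → 0ℚ ℚ.< ε →
      ∃[ N ] (∀ n → N ℕ.≤ n → ∣ seq x n ℚ.- seq y n ∣ ℚ.< ε)
open _≃_ public

private
  half : ∀ {ε} → 0ℚ ℚ.< ε → 0ℚ ℚ.< ½ ℚ.* ε
  half {ε} 0<ε = subst (λ z → z ℚ.< ½ ℚ.* ε) (ℚₚ.*-zeroʳ ½) (ℚₚ.*-monoʳ-<-pos ½ 0<ε)

  half+half : ∀ ε → ½ ℚ.* ε ℚ.+ ½ ℚ.* ε ≡ ε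
  half+half ε = trans (sym (ℚₚ.*-distribʳ-+ ε ½ ½)) (ℚₚ.*-identityˡ ε)

  scale : ∀ D → 0ℚ ℚ.< D → ∀ ε → 0ℚ ℚ.< ε → ∃[ δ ] (0ℚ ℚ.< δ × D ℚ.* δ ≡ ε)
  scale D 0<D ε 0<ε = D⁻¹ ℚ.* ε , 0<δ , Dδ≡ε
    where
    instance
      D>0 = ℚ.positive 0<D
      D≢0 = ℚₚ.pos⇒nonZero D
    D⁻¹ = ℚ.1/ D
    0<δ : 0ℚ ℚ.< D⁻¹ ℚ.* ε
    0<δ = subst (λ z → z ℚ.< D⁻¹ ℚ.* ε) (ℚₚ.*-zeroʳ D⁻¹)
      (ℚₚ.*-monoʳ-<-pos D⁻¹ {{ℚₚ.1/pos⇒pos D}} 0<ε)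
    Dδ≡ε : D ℚ.* (D⁻¹ ℚ.* ε) ≡ ε
    Dδ≡ε = trans (sym (ℚₚ.*-assoc D D⁻¹ ε))
      (trans (cong (ℚ._* ε) (ℚₚ.*-inverseʳ D)) (ℚₚ.*-identityˡ ε))

  ∣-∣-sym : ∀ p q → ∣ p ℚ.- q ∣ ≡ ∣ q ℚ.- p ∣
  ∣-∣-sym p q = trans
    (cong ∣_∣ (solve 2 (λ p q → p :- q := :- (q :- p)) refl p q))
    (ℚₚ.∣-p∣≡∣p∣ (q ℚ.- p))
    where open +-*-Solver

  neg-close : ∀ p p′ → ∣ ℚ.- p ℚ.- ℚ.- p′ ∣ ≡ ∣ p ℚ.- p′ ∣
  neg-close p p′ = trans
    (cong ∣_∣ (solve 2 (λ p q → :- p :- :- q := :- (p :- q)) refl p p′))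
    (ℚₚ.∣-p∣≡∣p∣ (p ℚ.- p′))
    where open +-*-Solver

  +-close : ∀ p p′ q q′ {δ δ′} → ∣ p ℚ.- p′ ∣ ℚ.< δ → ∣ q ℚ.- q′ ∣ ℚ.< δ′ →
    ∣ (p ℚ.+ q) ℚ.- (p′ ℚ.+ q′) ∣ ℚ.< δ ℚ.+ δ′
  +-close p p′ q q′ {δ} {δ′} <δ <δ′ = begin-strict
    ∣ (p ℚ.+ q) ℚ.- (p′ ℚ.+ q′) ∣      ≡⟨ cong ∣_∣ (solve 4 (λ p p′ q q′ →
      (p :+ q) :- (p′ :+ q′) := (p :- p′) :+ (q :- q′)) refl p p′ q q′) ⟩
    ∣ (p ℚ.- p′) ℚ.+ (q ℚ.- q′) ∣      ≤⟨ ℚₚ.∣p+q∣≤∣p∣+∣q∣ (p ℚ.- p′) (q ℚ.- q′) ⟩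
    ∣ p ℚ.- p′ ∣ ℚ.+ ∣ q ℚ.- q′ ∣      <⟨ ℚₚ.+-mono-< <δ <δ′ ⟩
    δ ℚ.+ δ′                           ∎
    where
    open ℚₚ.≤-Reasoning
    open +-*-Solver

  *-close : ∀ p p′ q q′ {B C δ ε} → 0ℚ ℚ.< B → 0ℚ ℚ.< C →
    ∣ p ∣ ℚ.≤ B → ∣ q′ ∣ ℚ.≤ C →
    (B ℚ.+ C) ℚ.* δ ≡ ε → ∣ p ℚ.- p′ ∣ ℚ.< δ → ∣ q ℚ.- q′ ∣ ℚ.< δ →
    ∣ p ℚ.* q ℚ.- p′ ℚ.* q′ ∣ ℚ.< ε
  *-close p p′ q q′ {B} {C} {δ} {ε} 0<B 0<C ≤B ≤C eq p<δ q<δ = begin-strict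
    ∣ p ℚ.* q ℚ.- p′ ℚ.* q′ ∣
      ≡⟨ cong ∣_∣ (solve 4 (λ p p′ q q′ →
           p :* q :- p′ :* q′ := p :* (q :- q′) :+ q′ :* (p :- p′)) refl p p′ q q′) ⟩
    ∣ p ℚ.* (q ℚ.- q′) ℚ.+ q′ ℚ.* (p ℚ.- p′) ∣
      ≤⟨ ℚₚ.∣p+q∣≤∣p∣+∣q∣ (p ℚ.* (q ℚ.- q′)) (q′ ℚ.* (p ℚ.- p′)) ⟩
    ∣ p ℚ.* (q ℚ.- q′) ∣ ℚ.+ ∣ q′ ℚ.* (p ℚ.- p′) ∣
      ≡⟨ cong₂ ℚ._+_ (ℚₚ.∣p*q∣≡∣p∣*∣q∣ p (q ℚ.- q′)) (ℚₚ.∣p*q∣≡∣p∣*∣q∣ q′ (p ℚ.- p′)) ⟩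
    ∣ p ∣ ℚ.* ∣ q ℚ.- q′ ∣ ℚ.+ ∣ q′ ∣ ℚ.* ∣ p ℚ.- p′ ∣
      ≤⟨ ℚₚ.+-mono-≤ (grow (q ℚ.- q′) ≤B) (grow (p ℚ.- p′) ≤C) ⟩
    B ℚ.* ∣ q ℚ.- q′ ∣ ℚ.+ C ℚ.* ∣ p ℚ.- p′ ∣
      <⟨ ℚₚ.+-mono-< (ℚₚ.*-monoʳ-<-pos B {{ℚ.positive 0<B}} q<δ)
                     (ℚₚ.*-monoʳ-<-pos C {{ℚ.positive 0<C}} p<δ) ⟩
    B ℚ.* δ ℚ.+ C ℚ.* δ
      ≡⟨ ℚₚ.*-distribʳ-+ δ B C ⟨
    (B ℚ.+ C) ℚ.* δ
      ≡⟨ eq ⟩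
    ε ∎
    where
    open ℚₚ.≤-Reasoning
    open +-*-Solver
    grow : ∀ r {u v} → u ℚ.≤ v → u ℚ.* ∣ r ∣ ℚ.≤ v ℚ.* ∣ r ∣
    grow r = ℚₚ.*-monoʳ-≤-nonNeg ∣ r ∣ {{ℚ.nonNegative (ℚₚ.0≤∣p∣ r)}}

  pos+pos : ∀ {p q} → 0ℚ ℚ.< p → 0ℚ ℚ.< q → 0ℚ ℚ.< p ℚ.+ q
  pos+pos = ℚₚ.+-mono-<

  bounded : (x : ℝ) → ∃[ B ] (0ℚ ℚ.< B × ∃[ N ] (∀ n → N ℕ.≤ n → ∣ seq x n ∣ ℚ.≤ B))
  bounded x with cauchy x 1ℚ (ℚₚ.positive⁻¹ 1ℚ)
  ... | N , near = B , 0<B , N , λ n N≤n → begin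
      ∣ seq x n ∣                                ≡⟨ cong ∣_∣ (solve 2 (λ p q → p := (p :- q) :+ q) refl (seq x n) (seq x N)) ⟩
      ∣ (seq x n ℚ.- seq x N) ℚ.+ seq x N ∣      ≤⟨ ℚₚ.∣p+q∣≤∣p∣+∣q∣ (seq x n ℚ.- seq x N) (seq x N) ⟩
      ∣ seq x n ℚ.- seq x N ∣ ℚ.+ ∣ seq x N ∣    ≤⟨ ℚₚ.+-monoˡ-≤ ∣ seq x N ∣ (ℚₚ.<⇒≤ (near n N N≤n ℕₚ.≤-refl)) ⟩
      B                                          ∎
    where
    open ℚₚ.≤-Reasoning
    open +-*-Solver
    B = 1ℚ ℚ.+ ∣ seq x N ∣
    0<B : 0ℚ ℚ.< B
    0<B = ℚₚ.+-mono-<-≤ (ℚₚ.positive⁻¹ 1ℚ) (ℚₚ.0≤∣p∣ (seq x N))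

  ⊔ˡ : ∀ {a b n} → a ℕ.⊔ b ℕ.≤ n → a ℕ.≤ n
  ⊔ˡ {a} {b} = ℕₚ.m⊔n≤o⇒m≤o a b

  ⊔ʳ : ∀ {a b n} → a ℕ.⊔ b ℕ.≤ n → b ℕ.≤ n
  ⊔ʳ {a} {b} = ℕₚ.m⊔n≤o⇒n≤o a b

pointwise : ∀ {x y} → (∀ n → seq x n ≡ seq y n) → x ≃ y
pointwise {x} {y} eq = mk≃ λ ε 0<ε → 0 , λ n _ →
  subst (ℚ._< ε) (sym (cong ∣_∣ (trans (cong (ℚ._- seq y n) (eq n)) (ℚₚ.+-inverseʳ (seq y n))))) 0<ε

fromℚ : ℚ → ℝ
fromℚ q .seq    _ = q
fromℚ q .cauchy ε 0<ε = 0 , λ _ _ _ _ → subst (ℚ._< ε) (sym (cong ∣_∣ (ℚₚ.+-inverseʳ q))) 0<ε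

fromℕ : ℕ → ℝ
fromℕ k = fromℚ (+ k ℚ./ 1)

infix  8 -_
infixl 7 _*_
infixl 6 _+_ _-_

0ℝ 1ℝ : ℝ
0ℝ = fromℚ 0ℚ
1ℝ = fromℚ 1ℚ

_+_ : ℝ → ℝ → ℝ
(x + y) .seq    n = seq x n ℚ.+ seq y n
(x + y) .cauchy ε 0<ε =
  let N , x-near = cauchy x (½ ℚ.* ε) (half 0<ε)
      M , y-near = cauchy y (½ ℚ.* ε) (half 0<ε)
  in N ℕ.⊔ M , λ m n ≤m ≤n → subst (_ ℚ.<_) (half+half ε)
       (+-close (seq x m) (seq x n) (seq y m) (seq y n)
         (x-near m n (⊔ˡ ≤m) (⊔ˡ ≤n)) (y-near m n (⊔ʳ {N} ≤m) (⊔ʳ {N} ≤n)))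

-_ : ℝ → ℝ
(- x) .seq    n = ℚ.- seq x n
(- x) .cauchy ε 0<ε =
  let N , near = cauchy x ε 0<ε
  in N , λ m n ≤m ≤n → subst (ℚ._< ε) (sym (neg-close (seq x m) (seq x n))) (near m n ≤m ≤n)

_-_ : ℝ → ℝ → ℝ
x - y = x + - y

_*_ : ℝ → ℝ → ℝ
(x * y) .seq    n = seq x n ℚ.* seq y n
(x * y) .cauchy ε 0<ε =
  let B , 0<B , N₁ , x≤B = bounded x
      C , 0<C , N₂ , y≤C = bounded y
      δ , 0<δ , eq       = scale (B ℚ.+ C) (pos+pos 0<B 0<C) ε 0<ε
      N₃ , x-near        = cauchy x δ 0<δ
      N₄ , y-near        = cauchy y δ 0<δ
  in (N₁ ℕ.⊔ N₂) ℕ.⊔ (N₃ ℕ.⊔ N₄) , λ m n ≤m ≤n →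
       *-close (seq x m) (seq x n) (seq y m) (seq y n) 0<B 0<C
         (x≤B m (⊔ˡ (⊔ˡ ≤m))) (y≤C n (⊔ʳ {N₁} (⊔ˡ ≤n))) eq
         (x-near m n (⊔ˡ (⊔ʳ {N₁ ℕ.⊔ N₂} ≤m)) (⊔ˡ (⊔ʳ {N₁ ℕ.⊔ N₂} ≤n)))
         (y-near m n (⊔ʳ {N₃} (⊔ʳ {N₁ ℕ.⊔ N₂} ≤m)) (⊔ʳ {N₃} (⊔ʳ {N₁ ℕ.⊔ N₂} ≤n)))

private
  ≃-sym : ∀ {x y} → x ≃ y → y ≃ x
  ≃-sym {x} {y} x≃y = mk≃ λ ε 0<ε →
    let N , near = converge x≃y ε 0<ε
    in N , λ n ≤n → subst (ℚ._< ε) (∣-∣-sym (seq x n) (seq y n)) (near n ≤n)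

  ≃-trans : ∀ {x y z} → x ≃ y → y ≃ z → x ≃ z
  ≃-trans {x} {y} {z} x≃y y≃z = mk≃ λ ε 0<ε →
    let N , xy = converge x≃y (½ ℚ.* ε) (half 0<ε)
        M , yz = converge y≃z (½ ℚ.* ε) (half 0<ε)
    in N ℕ.⊔ M , λ n ≤n → begin-strict
         ∣ seq x n ℚ.- seq z n ∣
           ≡⟨ cong ∣_∣ (solve 3 (λ p q r → p :- r := (p :+ q) :- (q :+ r)) refl (seq x n) (seq y n) (seq z n)) ⟩
         ∣ (seq x n ℚ.+ seq y n) ℚ.- (seq y n ℚ.+ seq z n) ∣
           <⟨ +-close (seq x n) (seq y n) (seq y n) (seq z n) (xy n (⊔ˡ ≤n)) (yz n (⊔ʳ {N} ≤n)) ⟩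
         ½ ℚ.* ε ℚ.+ ½ ℚ.* ε
           ≡⟨ half+half ε ⟩
         ε ∎
    where
    open ℚₚ.≤-Reasoning
    open +-*-Solver

  +-cong : ∀ {x x′ y y′} → x ≃ x′ → y ≃ y′ → x + y ≃ x′ + y′
  +-cong {x} {x′} {y} {y′} x≃x′ y≃y′ = mk≃ λ ε 0<ε →
    let N , xx′ = converge x≃x′ (½ ℚ.* ε) (half 0<ε)
        M , yy′ = converge y≃y′ (½ ℚ.* ε) (half 0<ε)
    in N ℕ.⊔ M , λ n ≤n → subst (_ ℚ.<_) (half+half ε)
         (+-close (seq x n) (seq x′ n) (seq y n) (seq y′ n) (xx′ n (⊔ˡ ≤n)) (yy′ n (⊔ʳ {N} ≤n)))

  neg-cong : ∀ {x y} → x ≃ y → - x ≃ - y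
  neg-cong {x} {y} x≃y = mk≃ λ ε 0<ε →
    let N , near = converge x≃y ε 0<ε
    in N , λ n ≤n → subst (ℚ._< ε) (sym (neg-close (seq x n) (seq y n))) (near n ≤n)

  *-cong : ∀ {x x′ y y′} → x ≃ x′ → y ≃ y′ → x * y ≃ x′ * y′
  *-cong {x} {x′} {y} {y′} x≃x′ y≃y′ = mk≃ λ ε 0<ε →
    let B , 0<B , N₁ , x≤B  = bounded x
        C , 0<C , N₂ , y′≤C = bounded y′
        δ , 0<δ , eq        = scale (B ℚ.+ C) (pos+pos 0<B 0<C) ε 0<ε
        N₃ , xx′            = converge x≃x′ δ 0<δ
        N₄ , yy′            = converge y≃y′ δ 0<δ
    in (N₁ ℕ.⊔ N₂) ℕ.⊔ (N₃ ℕ.⊔ N₄) , λ n ≤n →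
         *-close (seq x n) (seq x′ n) (seq y n) (seq y′ n) 0<B 0<C
           (x≤B n (⊔ˡ (⊔ˡ ≤n))) (y′≤C n (⊔ʳ {N₁} (⊔ˡ ≤n))) eq
           (xx′ n (⊔ˡ (⊔ʳ {N₁ ℕ.⊔ N₂} ≤n))) (yy′ n (⊔ʳ {N₃} (⊔ʳ {N₁ ℕ.⊔ N₂} ≤n)))

ℝ-commutativeRing : CommutativeRing 0ℓ 0ℓ
ℝ-commutativeRing = record
  { Carrier = ℝ
  ; _≈_ = _≃_
  ; _+_ = _+_
  ; _*_ = _*_
  ; -_  = -_
  ; 0#  = 0ℝ
  ; 1#  = 1ℝ
  ; isCommutativeRing = record
    { isRing = record
      { +-isAbelianGroup = record
        { isGroup = record
          { isMonoid = record
            { isSemigroup = record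
              { isMagma = record
                { isEquivalence = record
                  { refl = pointwise λ _ → refl ; sym = ≃-sym ; trans = ≃-trans }
                ; ∙-cong = +-cong
                }
              ; assoc = λ x y z → pointwise λ n → ℚₚ.+-assoc (seq x n) (seq y n) (seq z n)
              }
            ; identity = (λ x → pointwise λ n → ℚₚ.+-identityˡ (seq x n))
                       , (λ x → pointwise λ n → ℚₚ.+-identityʳ (seq x n))
            }
          ; inverse = (λ x → pointwise λ n → ℚₚ.+-inverseˡ (seq x n))
                    , (λ x → pointwise λ n → ℚₚ.+-inverseʳ (seq x n))
          ; ⁻¹-cong = neg-cong
          }
        ; comm = λ x y → pointwise λ n → ℚₚ.+-comm (seq x n) (seq y n)
        }
      ; *-cong = *-cong
      ; *-assoc = λ x y z → pointwise λ n → ℚₚ.*-assoc (seq x n) (seq y n) (seq z n)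
      ; *-identity = (λ x → pointwise λ n → ℚₚ.*-identityˡ (seq x n))
                   , (λ x → pointwise λ n → ℚₚ.*-identityʳ (seq x n))
      ; distrib = (λ x y z → pointwise λ n → ℚₚ.*-distribˡ-+ (seq x n) (seq y n) (seq z n))
                , (λ x y z → pointwise λ n → ℚₚ.*-distribʳ-+ (seq x n) (seq y n) (seq z n))
      }
    ; *-comm = λ x y → pointwise λ n → ℚₚ.*-comm (seq x n) (seq y n)
    }
  }

open Algebra.Properties.Semiring.Exp (CommutativeRing.semiring ℝ-commutativeRing) public
  using (_^_)
open Algebra.Properties.CommutativeMonoid.Sum (CommutativeRing.+-commutativeMonoid ℝ-commutativeRing) public
  using (sum)

det₃ : (Fin 3 → Fin 3 → ℝ) → ℝ
det₃ a =   a 0F 0F * (a 1F 1F * a 2F 2F - a 1F 2F * a 2F 1F)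
         - a 0F 1F * (a 1F 0F * a 2F 2F - a 1F 2F * a 2F 0F)
         + a 0F 2F * (a 1F 0F * a 2F 1F - a 1F 1F * a 2F 0F)

data Shape : Set where
  infinite : Shape
  finite   : (N : ℕ) → 3 ℕ.≤ N → Shape

InArray : Shape → ℤ → ℤ → Set
InArray infinite     i j = ℤ.- + 2 ℤ.≤ j ℤ.- i
InArray (finite N _) i j = ℤ.- + 2 ℤ.≤ j ℤ.- i × j ℤ.- i ℤ.≤ + N ℤ.- + 2

-- The membership proofs are irrelevant, so an entry depends on its position only.
Array : Shape → Set
Array σ = ∀ i j → .(InArray σ i j) → ℝ

EndsWithOnesAndZeros : ∀ σ → Array σ → Set
EndsWithOnesAndZeros infinite     m = ⊤
EndsWithOnesAndZeros (finite N _) m =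
    (∀ i .p → m i (i ℤ.+ + N ℤ.- + 3) p ≃ 1ℝ)
  × (∀ i .p → m i (i ℤ.+ + N ℤ.- + 2) p ≃ 0ℝ)

record Frieze : Set where
  field
    shape      : Shape
    entry      : Array shape
    zeros      : ∀ i .p → entry i (i ℤ.- + 2) p ≃ 0ℝ
    ones       : ∀ i .p → entry i (i ℤ.- + 1) p ≃ 1ℝ
    unimodular : ∀ i j .p .q .r .s →
        entry i j p * entry (i ℤ.+ + 1) (j ℤ.+ + 1) q
      - entry i (j ℤ.+ + 1) r * entry (i ℤ.+ + 1) j s ≃ 1ℝ
    end        : EndsWithOnesAndZeros shape entry
open Frieze public

Tame : Frieze → Set
Tame F = ∀ i j
  .(p : ∀ (r c : Fin 3) → InArray (shape F) (i ℤ.+ + toℕ c) (j ℤ.+ + toℕ r)) →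
  det₃ (λ r c → entry F (i ℤ.+ + toℕ c) (j ℤ.+ + toℕ r) (p r c)) ≃ 0ℝ

Periodic : Frieze → ℕ → Set
Periodic F n = 1 ℕ.≤ n ×
  (∀ i j .p .q → entry F (i ℤ.+ + n) (j ℤ.+ + n) p ≃ entry F i j q)

MinimalPeriod : Frieze → ℕ → Set
MinimalPeriod F n = Periodic F n × (∀ n′ → Periodic F n′ → n ℕ.≤ n′)

Mirrored : Shape → (ℤ → ℤ → ℝ) → Set
Mirrored infinite m =
  ∀ i j → j ℤ.- i ℤ.< ℤ.- + 2 → m i j ≃ - m (j ℤ.+ + 2) (i ℤ.- + 2)
Mirrored (finite N _) m =
    (∀ i j → m i j ≃ - m (j ℤ.+ + 2) (i ℤ.- + 2))
  × (∀ i j → m i j ≃ - m (j ℤ.- + N ℤ.+ + 2) (i ℤ.+ + N ℤ.- + 2))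

-- Each array has exactly one lattice, up to _≃_: the reflections preserve
-- i + j, and the array is a fundamental domain for them (on the mirrors
-- themselves the entries are zero). In the infinite case there is one mirror.
record IsLattice (F : Frieze) (m : ℤ → ℤ → ℝ) : Set where
  field
    extends  : ∀ i j .p → m i j ≃ entry F i j p
    mirrored : Mirrored (shape F) m
open IsLattice public

growth : (ℤ → ℤ → ℝ) → ℕ → ℕ → ℝ
growth m n zero      = fromℕ 2
growth m n k@(suc _) = m (+ 1) (+ (k ℕ.* n)) - m (+ 2) (+ (k ℕ.* n) ℤ.- + 1)

-- With l = 1 + i and l ≤ ⌊k/2⌋, the denominator k - l is positive.
k∸l-nonZero : ∀ k (i : Fin ⌊ k /2⌋) → ℕ.NonZero (k ℕ.∸ suc (toℕ i))
k∸l-nonZero (suc k) i =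
  ℕ.>-nonZero (ℕₚ.m<n⇒0<n∸m (ℕₚ.≤-<-trans (toℕ<n i) (ℕₚ.⌊n/2⌋<n k)))

{-# OPTIONS --safe #-}

-- In a tame frieze, the singular 3 × 3 blocks and their 2 × 2 minors equal to 1
-- give m i j = a j * m i (j - 1) - m i (j - 2) with a j = m j j, and dually in i.
-- The dual form is what lets the recurrence pass through the mirrors, so it
-- holds in the whole lattice. Hence x t = m 1 (t - 1) and y t = m 2 (t - 1) form
-- a basis of solutions of one linear recurrence with n-periodic coefficients and
-- constant Wronskian, and s k is the trace of the k-th power of its monodromy
-- matrix, which has determinant 1: Cayley-Hamilton gives (a).
-- For (b), s (k + 2) = U (k + 2) - U k, where U k = ∑ (-1)^l ((k - l) C l) s₁^(k - 2l),
-- and k / (k - l) * ((k - l) C l) = ((k - l) C l) + ((k - l - 1) C (l - 1)).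
module Submission where

open import Defs
open import Algebra.Bundles using (CommutativeRing)
import Algebra.Properties.Monoid.Sum
import Algebra.Properties.Semiring.Sum
import Algebra.Solver.Ring
open import Algebra.Solver.Ring.AlmostCommutativeRing
  using (fromCommutativeRing; _-Raw-AlmostCommutative⟶_)
open import Data.Fin.Base using (Fin; toℕ)
open import Data.Fin.Patterns using (0F; 1F; 2F)
import Data.Fin.Properties as Finₚ
open import Data.Integer.Base as ℤ using (ℤ; +_)
import Data.Integer.Properties as ℤₚ
import Data.Integer.Solver
import Data.Maybe.Base as Maybe
open import Data.Nat.Base as ℕ using (ℕ; zero; suc; _≤_; _<_; _∸_; ⌊_/2⌋; z≤n; s≤s)
open import Data.Nat.Combinatorics using (_C_; nCk+nC[k+1]≡[n+1]C[k+1]; k>n⇒nCk≡0; nC1≡n)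
open import Data.Nat.Induction using (<-rec)
import Data.Nat.Properties as ℕₚ
open import Data.Product.Base using (_×_; _,_; proj₁; proj₂)
open import Data.Rational.Base as ℚ using (0ℚ; 1ℚ; _/_)
import Data.Rational.Properties as ℚₚ
import Data.Rational.Unnormalised.Base as ℚᵘ
import Data.Rational.Unnormalised.Properties as ℚᵘₚ
open import Data.Sum.Base using (_⊎_; inj₁; inj₂)
open import Data.Unit.Base using (⊤; tt)
open import Function.Base using (_∘_)
open import Relation.Binary.Consequences using (dec⇒weaklyDec)
open import Relation.Binary.PropositionalEquality
  using (_≡_; refl; sym; trans; cong; cong₂; subst; module ≡-Reasoning)
import Relation.Binary.Reasoning.Setoid

-- Ring solvers for real and integer identities.

module R = CommutativeRing ℝ-commutativeRing
module ≃-Reasoning = Relation.Binary.Reasoning.Setoid R.setoid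

private
  fromℚ-morphism : ℚₚ.+-*-rawRing -Raw-AlmostCommutative⟶ fromCommutativeRing ℝ-commutativeRing
  fromℚ-morphism = record
    { ⟦_⟧    = fromℚ
    ; +-homo = λ _ _ → pointwise λ _ → refl
    ; *-homo = λ _ _ → pointwise λ _ → refl
    ; -‿homo = λ _ → pointwise λ _ → refl
    ; 0-homo = R.refl
    ; 1-homo = R.refl
    }

  -- Equality of Cauchy sequences is not decidable, so the solver normalises with rational
  -- coefficients, where it is.
  fromℚ-≟ : ∀ p q → Maybe.Maybe (fromℚ p ≃ fromℚ q)
  fromℚ-≟ p q = Maybe.map (λ p≡q → R.reflexive (cong fromℚ p≡q)) (dec⇒weaklyDec ℚₚ._≟_ p q)

module ℝ-Solver = Algebra.Solver.Ring ℚₚ.+-*-rawRing (fromCommutativeRing ℝ-commutativeRing)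
  fromℚ-morphism fromℚ-≟
open ℝ-Solver using (solve; _:+_; _:*_; _:-_; :-_; _:=_; con)

open Algebra.Properties.Semiring.Sum R.semiring using (*-distribˡ-sum)
open Algebra.Properties.Monoid.Sum R.+-monoid using (sum-cong-≋; sum-init-last)

module ℤ-Solver = Data.Integer.Solver.+-*-Solver
open ℤ-Solver using ()
  renaming (solve to solveᶻ; _:+_ to _⊕_; _:*_ to _⊗_; _:-_ to _⊖_; :-_ to ⊖_; _:=_ to _⊜_; con to κ)

-- Binomial coefficients and fractions

-- Induction along Pascal's rule: one copy of `p` is set aside, and the two induction hypotheses
-- recombine, again by Pascal's rule, into `suc n` further copies.
absorption : ∀ n k → suc k ℕ.* (suc n C suc k) ≡ suc n ℕ.* (n C k)
absorption n       zero    = trans (cong (1 ℕ.*_) (nC1≡n (suc n))) (ℕₚ.*-comm 1 (suc n))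
absorption zero    (suc k) = ℕₚ.*-zeroʳ (2 ℕ.+ k)
absorption (suc n) (suc k) = begin
  suc (suc k) ℕ.* (suc (suc n) C suc (suc k))
    ≡⟨ cong (suc (suc k) ℕ.*_) (nCk+nC[k+1]≡[n+1]C[k+1] (suc n) (suc k)) ⟨
  suc (suc k) ℕ.* (p ℕ.+ q)
    ≡⟨ ℕₚ.*-distribˡ-+ (suc (suc k)) p q ⟩
  (p ℕ.+ suc k ℕ.* p) ℕ.+ suc (suc k) ℕ.* q
    ≡⟨ cong₂ (λ u v → (p ℕ.+ u) ℕ.+ v) (absorption n k) (absorption n (suc k)) ⟩
  (p ℕ.+ suc n ℕ.* (n C k)) ℕ.+ suc n ℕ.* (n C suc k)
    ≡⟨ ℕₚ.+-assoc p (suc n ℕ.* (n C k)) (suc n ℕ.* (n C suc k)) ⟩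
  p ℕ.+ (suc n ℕ.* (n C k) ℕ.+ suc n ℕ.* (n C suc k))
    ≡⟨ cong (p ℕ.+_) (ℕₚ.*-distribˡ-+ (suc n) (n C k) (n C suc k)) ⟨
  p ℕ.+ suc n ℕ.* (n C k ℕ.+ n C suc k)
    ≡⟨ cong (λ u → p ℕ.+ suc n ℕ.* u) (nCk+nC[k+1]≡[n+1]C[k+1] n k) ⟩
  suc (suc n) ℕ.* (suc n C suc k) ∎
  where
  open ≡-Reasoning
  p = suc n C suc k
  q = suc n C suc (suc k)

-- Rationals are stored in lowest terms; passing to unnormalised fractions reduces their arithmetic
-- to cross multiplication of integers.
fromℚᵘ-homo-+ : ∀ p q → ℚ.fromℚᵘ (p ℚᵘ.+ q) ≡ ℚ.fromℚᵘ p ℚ.+ ℚ.fromℚᵘ q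
fromℚᵘ-homo-+ p q = ℚₚ.toℚᵘ-injective (begin
  ℚ.toℚᵘ (ℚ.fromℚᵘ (p ℚᵘ.+ q))                        ≈⟨ ℚₚ.toℚᵘ-fromℚᵘ (p ℚᵘ.+ q) ⟩
  p ℚᵘ.+ q                                            ≈⟨ ℚᵘₚ.+-cong (ℚₚ.toℚᵘ-fromℚᵘ p) (ℚₚ.toℚᵘ-fromℚᵘ q) ⟨
  ℚ.toℚᵘ (ℚ.fromℚᵘ p) ℚᵘ.+ ℚ.toℚᵘ (ℚ.fromℚᵘ q)        ≈⟨ ℚₚ.toℚᵘ-homo-+ (ℚ.fromℚᵘ p) (ℚ.fromℚᵘ q) ⟨
  ℚ.toℚᵘ (ℚ.fromℚᵘ p ℚ.+ ℚ.fromℚᵘ q)                  ∎)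
  where open import Relation.Binary.Reasoning.Setoid ℚᵘₚ.≃-setoid

fromℚᵘ-homo-* : ∀ p q → ℚ.fromℚᵘ (p ℚᵘ.* q) ≡ ℚ.fromℚᵘ p ℚ.* ℚ.fromℚᵘ q
fromℚᵘ-homo-* p q = ℚₚ.toℚᵘ-injective (begin
  ℚ.toℚᵘ (ℚ.fromℚᵘ (p ℚᵘ.* q))                        ≈⟨ ℚₚ.toℚᵘ-fromℚᵘ (p ℚᵘ.* q) ⟩
  p ℚᵘ.* q                                            ≈⟨ ℚᵘₚ.*-cong (ℚₚ.toℚᵘ-fromℚᵘ p) (ℚₚ.toℚᵘ-fromℚᵘ q) ⟨
  ℚ.toℚᵘ (ℚ.fromℚᵘ p) ℚᵘ.* ℚ.toℚᵘ (ℚ.fromℚᵘ q)        ≈⟨ ℚₚ.toℚᵘ-homo-* (ℚ.fromℚᵘ p) (ℚ.fromℚᵘ q) ⟨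
  ℚ.toℚᵘ (ℚ.fromℚᵘ p ℚ.* ℚ.fromℚᵘ q)                  ∎)
  where open import Relation.Binary.Reasoning.Setoid ℚᵘₚ.≃-setoid

fromℕ-+ : ∀ a b → fromℕ (a ℕ.+ b) ≃ fromℕ a + fromℕ b
fromℕ-+ a b = pointwise λ _ → trans
  (ℚₚ.fromℚᵘ-cong {ℚᵘ.mkℚᵘ (+ (a ℕ.+ b)) 0} {ℚᵘ.mkℚᵘ (+ a) 0 ℚᵘ.+ ℚᵘ.mkℚᵘ (+ b) 0} (ℚᵘ.*≡* (solveᶻ 2
    (λ a b → (a ⊕ b) ⊗ κ (+ 1) ⊜ (a ⊗ κ (+ 1) ⊕ b ⊗ κ (+ 1)) ⊗ κ (+ 1)) refl (+ a) (+ b))))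
  (fromℚᵘ-homo-+ (ℚᵘ.mkℚᵘ (+ a) 0) (ℚᵘ.mkℚᵘ (+ b) 0))

-- The product is gathered into one unnormalised fraction, and cross multiplication turns the claim
-- into the hypothesis on natural numbers. Matching `d` as a successor supplies the `d-1` that
-- `mkℚᵘ` stores.
cancel-denominator : ∀ k c d e .{{_ : ℕ.NonZero d}} → k ℕ.* c ≡ d ℕ.* e →
  fromℕ k * (fromℚ (+ 1 / d) * fromℕ c) ≃ fromℕ e
cancel-denominator k c d@(suc d-1) e kc≡de = pointwise λ _ → begin
  ℚ.fromℚᵘ k/1 ℚ.* (ℚ.fromℚᵘ 1/d ℚ.* ℚ.fromℚᵘ c/1)   ≡⟨ cong (ℚ.fromℚᵘ k/1 ℚ.*_) (fromℚᵘ-homo-* 1/d c/1) ⟨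
  ℚ.fromℚᵘ k/1 ℚ.* ℚ.fromℚᵘ (1/d ℚᵘ.* c/1)           ≡⟨ fromℚᵘ-homo-* k/1 (1/d ℚᵘ.* c/1) ⟨
  ℚ.fromℚᵘ (k/1 ℚᵘ.* (1/d ℚᵘ.* c/1))
    ≡⟨ ℚₚ.fromℚᵘ-cong {k/1 ℚᵘ.* (1/d ℚᵘ.* c/1)} {ℚᵘ.mkℚᵘ (+ e) 0} (ℚᵘ.*≡* cross) ⟩
  + e / 1                                            ∎
  where
  open ≡-Reasoning
  k/1 = ℚᵘ.mkℚᵘ (+ k) 0
  1/d = ℚᵘ.mkℚᵘ (+ 1) d-1
  c/1 = ℚᵘ.mkℚᵘ (+ c) 0
  cross : + k ℤ.* (+ 1 ℤ.* + c) ℤ.* + 1 ≡ + e ℤ.* + (1 ℕ.* (d ℕ.* 1))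
  cross = begin
    + k ℤ.* (+ 1 ℤ.* + c) ℤ.* + 1        ≡⟨ ℤₚ.*-identityʳ (+ k ℤ.* (+ 1 ℤ.* + c)) ⟩
    + k ℤ.* (+ 1 ℤ.* + c)                ≡⟨ cong (+ k ℤ.*_) (ℤₚ.*-identityˡ (+ c)) ⟩
    + k ℤ.* + c                          ≡⟨ ℤₚ.pos-* k c ⟨
    + (k ℕ.* c)                          ≡⟨ cong +_ kc≡de ⟩
    + (d ℕ.* e)                          ≡⟨ cong +_ (ℕₚ.*-comm d e) ⟩
    + (e ℕ.* d)                          ≡⟨ cong (λ u → + (e ℕ.* u)) (trans (ℕₚ.*-identityˡ (d ℕ.* 1)) (ℕₚ.*-identityʳ d)) ⟨
    + (e ℕ.* (1 ℕ.* (d ℕ.* 1)))          ≡⟨ ℤₚ.pos-* e (1 ℕ.* (d ℕ.* 1)) ⟩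
    + e ℤ.* + (1 ℕ.* (d ℕ.* 1))          ∎

-- Finite sums over initial segments, and halving.

∑< : ℕ → (ℕ → ℝ) → ℝ
∑< n f = sum {n} (λ i → f (toℕ i))

∑<-cong : ∀ n {f g} → (∀ i → i < n → f i ≃ g i) → ∑< n f ≃ ∑< n g
∑<-cong n f≃g = sum-cong-≋ {n} (λ i → f≃g (toℕ i) (Finₚ.toℕ<n i))

∑<-suc : ∀ n f → ∑< (suc n) f ≃ ∑< n f + f n
∑<-suc n f = R.trans (sum-init-last (λ (i : Fin (suc n)) → f (toℕ i)))
  (R.+-cong (sum-cong-≋ {n} (λ i → R.reflexive (cong f (Finₚ.toℕ-inject₁ i))))
            (R.reflexive (cong f (Finₚ.toℕ-fromℕ n))))

∑<-distrib-minus : ∀ n f g → ∑< n (λ i → f i - g i) ≃ ∑< n f - ∑< n g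
∑<-distrib-minus zero    f g = solve 0 (con 0ℚ := con 0ℚ :- con 0ℚ) R.refl
∑<-distrib-minus (suc n) f g = R.trans
  (R.+-congˡ (∑<-distrib-minus n (f ∘ suc) (g ∘ suc)))
  (solve 4 (λ a b c d → (a :- b) :+ (c :- d) := (a :+ c) :- (b :+ d)) R.refl
    (f 0) (g 0) (∑< n (f ∘ suc)) (∑< n (g ∘ suc)))

*-distribˡ-∑< : ∀ n x f → x * ∑< n f ≃ ∑< n (λ i → x * f i)
*-distribˡ-∑< n x f = *-distribˡ-sum {n} x (λ i → f (toℕ i))

-- The even case also records `n` as twice its half: there the two sums of `∑<-mixed` differ in
-- length, and this equation makes the extra summand vanish.
⌊n/2⌋-parity : ∀ n → (⌊ suc n /2⌋ ≡ ⌊ n /2⌋ × n ≡ ⌊ n /2⌋ ℕ.+ ⌊ n /2⌋) ⊎ ⌊ suc n /2⌋ ≡ suc ⌊ n /2⌋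
⌊n/2⌋-parity zero          = inj₁ (refl , refl)
⌊n/2⌋-parity (suc zero)    = inj₂ refl
⌊n/2⌋-parity (suc (suc n)) with ⌊n/2⌋-parity n
... | inj₁ (eq , n≡h+h) = inj₁ (cong suc eq , cong suc (trans (cong suc n≡h+h) (sym (ℕₚ.+-suc ⌊ n /2⌋ ⌊ n /2⌋))))
... | inj₂ eq           = inj₂ (cong suc eq)

i≤⌊n/2⌋⇒i≤n : ∀ {i} n → i ≤ ⌊ n /2⌋ → i ≤ n
i≤⌊n/2⌋⇒i≤n n i≤ = ℕₚ.≤-trans i≤ (ℕₚ.⌊n/2⌋≤n n)

-- Keeps the truncated subtraction in the exponent exact when a factor `s` is absorbed in
-- `*-term-suc`.
i<⌊n/2⌋⇒2i+2≤n : ∀ {i} n → i < ⌊ n /2⌋ → suc (suc (2 ℕ.* i)) ≤ n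
i<⌊n/2⌋⇒2i+2≤n {zero}  (suc (suc n)) _          = s≤s (s≤s z≤n)
i<⌊n/2⌋⇒2i+2≤n {suc i} (suc (suc n)) (s≤s i<)   =
  subst (_≤ suc (suc n)) (cong (λ u → suc (suc u)) (sym (ℕₚ.*-suc 2 i))) (s≤s (s≤s (i<⌊n/2⌋⇒2i+2≤n n i<)))

∸-2*suc : ∀ k i → suc (suc k) ∸ 2 ℕ.* suc i ≡ k ∸ 2 ℕ.* i
∸-2*suc k i = cong (suc (suc k) ∸_) (ℕₚ.*-suc 2 i)

-- Chebyshev polynomials

-- U k is the Chebyshev polynomial of the second kind, evaluated at s / 2.
module Chebyshev (s : ℝ) where

  monomial : (sgn c e : ℕ) → ℝ
  monomial sgn c e = (- 1ℝ) ^ sgn * fromℕ c * s ^ e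

  term : ℕ → ℕ → ℝ
  term k i = monomial i ((k ∸ i) C i) (k ∸ 2 ℕ.* i)

  term-zero : ∀ k → term k 0 ≃ s ^ k
  term-zero k = R.trans (R.*-congʳ (R.*-identityˡ (fromℕ 1))) (R.*-identityˡ (s ^ k))

  U : ℕ → ℝ
  U k = ∑< (suc ⌊ k /2⌋) (term k)

  -- The part of `term (2 + k) (suc i)` that Pascal's rule leaves beside `- term k i`. For `i` below
  -- `⌊ suc k /2⌋` it is also `s * term (1 + k) (suc i)`, so it links `U (2 + k)` to
  -- `s * U (1 + k)`.
  mixed : ℕ → ℕ → ℝ
  mixed k i = monomial (suc i) ((k ∸ i) C suc i) (k ∸ 2 ℕ.* i)

  term-suc-suc : ∀ k i → i ≤ k → term (2 ℕ.+ k) (suc i) ≃ mixed k i - term k i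
  term-suc-suc k i i≤k = begin
    monomial (suc i) ((suc k ∸ i) C suc i) (suc (suc k) ∸ 2 ℕ.* suc i)
      ≡⟨ cong₂ (monomial (suc i)) pascal (∸-2*suc k i) ⟩
    monomial (suc i) ((k ∸ i) C i ℕ.+ (k ∸ i) C suc i) (k ∸ 2 ℕ.* i)
      ≈⟨ R.*-congʳ (R.*-congˡ (fromℕ-+ ((k ∸ i) C i) ((k ∸ i) C suc i))) ⟩
    - 1ℝ * ε * (c + c′) * p
      ≈⟨ solve 4 (λ ε c c′ p → :- con 1ℚ :* ε :* (c :+ c′) :* p := :- con 1ℚ :* ε :* c′ :* p :- ε :* c :* p) R.refl ε c c′ p ⟩
    mixed k i - term k i ∎
    where
    open ≃-Reasoning
    ε  = (- 1ℝ) ^ i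
    c  = fromℕ ((k ∸ i) C i)
    c′ = fromℕ ((k ∸ i) C suc i)
    p  = s ^ (k ∸ 2 ℕ.* i)
    pascal : (suc k ∸ i) C suc i ≡ (k ∸ i) C i ℕ.+ (k ∸ i) C suc i
    pascal = trans (cong (_C suc i) (ℕₚ.+-∸-assoc 1 i≤k)) (sym (nCk+nC[k+1]≡[n+1]C[k+1] (k ∸ i) i))

  *-term-suc : ∀ k i → i < ⌊ suc k /2⌋ → s * term (suc k) (suc i) ≃ mixed k i
  *-term-suc k i i< = begin
    s * (ε * c * s ^ (suc k ∸ 2 ℕ.* suc i))
      ≈⟨ solve 4 (λ s ε c p → s :* (ε :* c :* p) := ε :* c :* (s :* p)) R.refl s ε c (s ^ (suc k ∸ 2 ℕ.* suc i)) ⟩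
    ε * c * s ^ suc (suc k ∸ 2 ℕ.* suc i)
      ≡⟨ cong (λ e → ε * c * s ^ e) exponent ⟩
    mixed k i ∎
    where
    open ≃-Reasoning
    ε = (- 1ℝ) ^ suc i
    c = fromℕ ((k ∸ i) C suc i)
    exponent : suc (suc k ∸ 2 ℕ.* suc i) ≡ k ∸ 2 ℕ.* i
    exponent = trans
      (sym (ℕₚ.+-∸-assoc 1 {suc k} {2 ℕ.* suc i} (subst (_≤ suc k) (sym (ℕₚ.*-suc 2 i)) (i<⌊n/2⌋⇒2i+2≤n (suc k) i<))))
      (∸-2*suc k i)

  -- For odd `k` the lengths agree. For even `k`, with half `h`, the longer sum ends in a summand
  -- whose binomial coefficient is `h C suc h`, which is zero.
  ∑<-mixed : ∀ k → ∑< ⌊ suc k /2⌋ (mixed k) ≃ ∑< (suc ⌊ k /2⌋) (mixed k)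
  ∑<-mixed k with ⌊n/2⌋-parity k
  ... | inj₂ eq = R.reflexive (cong (λ n → ∑< n (mixed k)) eq)
  ... | inj₁ (eq , k≡h+h) = begin
    ∑< ⌊ suc k /2⌋ (mixed k)                ≡⟨ cong (λ n → ∑< n (mixed k)) eq ⟩
    ∑< h (mixed k)                          ≈⟨ R.+-identityʳ (∑< h (mixed k)) ⟨
    ∑< h (mixed k) + 0ℝ                     ≈⟨ R.+-congˡ vanishing ⟨
    ∑< h (mixed k) + mixed k h              ≈⟨ ∑<-suc h (mixed k) ⟨
    ∑< (suc h) (mixed k)                    ∎
    where
    open ≃-Reasoning
    h = ⌊ k /2⌋
    hCsuch≡0 : (k ∸ h) C suc h ≡ 0
    hCsuch≡0 = trans (cong (_C suc h) (trans (cong (_∸ h) k≡h+h) (ℕₚ.m+n∸n≡m h h))) (k>n⇒nCk≡0 (ℕₚ.n<1+n h))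
    vanishing : mixed k h ≃ 0ℝ
    vanishing = R.trans
      (R.reflexive (cong (λ c → monomial (suc h) c (k ∸ 2 ℕ.* h)) hCsuch≡0))
      (solve 2 (λ ε p → ε :* con 0ℚ :* p := con 0ℚ) R.refl ((- 1ℝ) ^ suc h) (s ^ (k ∸ 2 ℕ.* h)))

  -- Apart from the leading power, every term of `U (2 + k)` splits by Pascal's rule. The mixed
  -- parts and the leading power make up `s * U (1 + k)`; the other parts make up `- U k`.
  U-recurrence : ∀ k → U (2 ℕ.+ k) ≃ s * U (1 ℕ.+ k) - U k
  U-recurrence k = begin
    term (2 ℕ.+ k) 0 + ∑< (suc h) (λ i → term (2 ℕ.+ k) (suc i))
      ≈⟨ R.+-cong (term-zero (2 ℕ.+ k))
           (∑<-cong (suc h) {λ i → term (2 ℕ.+ k) (suc i)} {λ i → mixed k i - term k i}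
             λ { i (s≤s i≤h) → term-suc-suc k i (i≤⌊n/2⌋⇒i≤n k i≤h) }) ⟩
    s * s ^ suc k + ∑< (suc h) (λ i → mixed k i - term k i)
      ≈⟨ R.+-cong (R.*-congˡ (R.sym (term-zero (suc k)))) (∑<-distrib-minus (suc h) (mixed k) (term k)) ⟩
    s * term (suc k) 0 + (∑< (suc h) (mixed k) - U k)
      ≈⟨ R.+-congˡ (R.+-congʳ (∑<-mixed k)) ⟨
    s * term (suc k) 0 + (∑< ⌊ suc k /2⌋ (mixed k) - U k)
      ≈⟨ R.+-congˡ (R.+-congʳ (∑<-cong ⌊ suc k /2⌋ {λ i → s * term (suc k) (suc i)} {mixed k} (*-term-suc k))) ⟨
    s * term (suc k) 0 + (∑< ⌊ suc k /2⌋ (λ i → s * term (suc k) (suc i)) - U k)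
      ≈⟨ R.+-congˡ (R.+-congʳ (*-distribˡ-∑< ⌊ suc k /2⌋ s (λ i → term (suc k) (suc i)))) ⟨
    s * term (suc k) 0 + (s * ∑< ⌊ suc k /2⌋ (λ i → term (suc k) (suc i)) - U k)
      ≈⟨ solve 4 (λ s a b u → s :* a :+ (s :* b :- u) := s :* (a :+ b) :- u) R.refl
           s (term (suc k) 0) (∑< ⌊ suc k /2⌋ (λ i → term (suc k) (suc i))) (U k) ⟩
    s * U (1 ℕ.+ k) - U k ∎
    where
    open ≃-Reasoning
    h = ⌊ k /2⌋

  U-one : U 1 ≃ s
  U-one = R.trans (R.+-congʳ (term-zero 1)) (solve 1 (λ s → s :* con 1ℚ :+ con 0ℚ := s) R.refl s)

  U-zero : U 0 ≃ 1ℝ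
  U-zero = R.trans (R.+-congʳ (term-zero 0)) (R.+-identityʳ 1ℝ)

  weighted-term : ∀ k i → i ≤ k → .{{_ : ℕ.NonZero (suc k ∸ i)}} →
    fromℕ (2 ℕ.+ k) * ((- 1ℝ) ^ suc i * fromℚ (+ 1 / (suc k ∸ i))
      * fromℕ ((suc k ∸ i) C suc i) * s ^ (2 ℕ.+ k ∸ 2 ℕ.* suc i))
      ≃ term (2 ℕ.+ k) (suc i) - term k i
  weighted-term k i i≤k = begin
    fromℕ (2 ℕ.+ k) * (- 1ℝ * ε * q * fromℕ c * s ^ (2 ℕ.+ k ∸ 2 ℕ.* suc i))
      ≈⟨ solve 5 (λ K ε q c p → K :* (:- con 1ℚ :* ε :* q :* c :* p) := :- con 1ℚ :* ε :* (K :* (q :* c)) :* p)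
           R.refl (fromℕ (2 ℕ.+ k)) ε q (fromℕ c) (s ^ (2 ℕ.+ k ∸ 2 ℕ.* suc i)) ⟩
    - 1ℝ * ε * (fromℕ (2 ℕ.+ k) * (q * fromℕ c)) * s ^ (2 ℕ.+ k ∸ 2 ℕ.* suc i)
      ≈⟨ R.*-congʳ (R.*-congˡ (R.trans
           (cancel-denominator (2 ℕ.+ k) c (suc k ∸ i) (c ℕ.+ c′) weights) (fromℕ-+ c c′))) ⟩
    - 1ℝ * ε * (fromℕ c + fromℕ c′) * s ^ (2 ℕ.+ k ∸ 2 ℕ.* suc i)
      ≈⟨ solve 4 (λ ε c c′ p → :- con 1ℚ :* ε :* (c :+ c′) :* p := :- con 1ℚ :* ε :* c :* p :- ε :* c′ :* p)
           R.refl ε (fromℕ c) (fromℕ c′) (s ^ (2 ℕ.+ k ∸ 2 ℕ.* suc i)) ⟩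
    term (2 ℕ.+ k) (suc i) - ε * fromℕ c′ * s ^ (2 ℕ.+ k ∸ 2 ℕ.* suc i)
      ≡⟨ cong (λ e → term (2 ℕ.+ k) (suc i) - ε * fromℕ c′ * s ^ e) (∸-2*suc k i) ⟩
    term (2 ℕ.+ k) (suc i) - term k i ∎
    where
    ε  = (- 1ℝ) ^ i
    q  = fromℚ (+ 1 / (suc k ∸ i))
    c  = (suc k ∸ i) C suc i
    c′ = (k ∸ i) C i
    d≡ : suc k ∸ i ≡ suc (k ∸ i)
    d≡ = ℕₚ.+-∸-assoc 1 i≤k
    -- The factor `2 + k` is split as `(suc k ∸ i) + suc i`: the first share already has the factor
    -- `suc k ∸ i`, and `absorption` produces it in the second, turning `c` into `c′`.
    weights : (2 ℕ.+ k) ℕ.* c ≡ (suc k ∸ i) ℕ.* (c ℕ.+ c′)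
    weights = begin
      (2 ℕ.+ k) ℕ.* c                              ≡⟨ cong (λ u → suc u ℕ.* c) (ℕₚ.m∸n+n≡m (ℕₚ.m≤n⇒m≤1+n i≤k)) ⟨
      suc (suc k ∸ i ℕ.+ i) ℕ.* c                  ≡⟨ cong (ℕ._* c) (ℕₚ.+-suc (suc k ∸ i) i) ⟨
      (suc k ∸ i ℕ.+ suc i) ℕ.* c                  ≡⟨ ℕₚ.*-distribʳ-+ c (suc k ∸ i) (suc i) ⟩
      (suc k ∸ i) ℕ.* c ℕ.+ suc i ℕ.* c            ≡⟨ cong (λ d → (suc k ∸ i) ℕ.* c ℕ.+ suc i ℕ.* (d C suc i)) d≡ ⟩
      (suc k ∸ i) ℕ.* c ℕ.+ suc i ℕ.* (suc (k ∸ i) C suc i)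
                                                   ≡⟨ cong ((suc k ∸ i) ℕ.* c ℕ.+_) (absorption (k ∸ i) i) ⟩
      (suc k ∸ i) ℕ.* c ℕ.+ suc (k ∸ i) ℕ.* c′     ≡⟨ cong (λ d → (suc k ∸ i) ℕ.* c ℕ.+ d ℕ.* c′) d≡ ⟨
      (suc k ∸ i) ℕ.* c ℕ.+ (suc k ∸ i) ℕ.* c′     ≡⟨ ℕₚ.*-distribˡ-+ (suc k ∸ i) c c′ ⟨
      (suc k ∸ i) ℕ.* (c ℕ.+ c′)                   ∎
      where open ≡-Reasoning
    open ≃-Reasoning

  closedForm : ℕ → ℝ
  closedForm k = s ^ k + fromℕ k * sum {⌊ k /2⌋} (λ i →
    let l = suc (toℕ i) in
    (- 1ℝ) ^ l * fromℚ (_/_ (+ 1) (k ∸ l) {{k∸l-nonZero k i}})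
      * fromℕ ((k ∸ l) C l) * s ^ (k ∸ 2 ℕ.* l))

  -- The leading power is `term (2 + k) 0`, and each weighted summand is a term of `U (2 + k)` minus
  -- a term of `U k`; both families are exhausted.
  closedForm-U : ∀ k → closedForm (2 ℕ.+ k) ≃ U (2 ℕ.+ k) - U k
  closedForm-U k = begin
    closedForm (2 ℕ.+ k)
      ≈⟨ R.+-cong (R.sym (term-zero (2 ℕ.+ k))) (*-distribˡ-sum {suc h} (fromℕ (2 ℕ.+ k)) (λ i →
           (- 1ℝ) ^ suc (toℕ i) * fromℚ (_/_ (+ 1) (suc k ∸ toℕ i) {{k∸l-nonZero (2 ℕ.+ k) i}})
             * fromℕ ((suc k ∸ toℕ i) C suc (toℕ i)) * s ^ (2 ℕ.+ k ∸ 2 ℕ.* suc (toℕ i)))) ⟩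
    term (2 ℕ.+ k) 0 + _
      ≈⟨ R.+-congˡ (sum-cong-≋ {suc h} λ i →
           weighted-term k (toℕ i) (i≤⌊n/2⌋⇒i≤n k (Finₚ.toℕ≤pred[n] i)) {{k∸l-nonZero (2 ℕ.+ k) i}}) ⟩
    term (2 ℕ.+ k) 0 + ∑< (suc h) (λ i → term (2 ℕ.+ k) (suc i) - term k i)
      ≈⟨ R.+-congˡ (∑<-distrib-minus (suc h) (λ i → term (2 ℕ.+ k) (suc i)) (term k)) ⟩
    term (2 ℕ.+ k) 0 + (∑< (suc h) (λ i → term (2 ℕ.+ k) (suc i)) - U k)
      ≈⟨ R.+-assoc (term (2 ℕ.+ k) 0) (∑< (suc h) (λ i → term (2 ℕ.+ k) (suc i))) (- U k) ⟨
    U (2 ℕ.+ k) - U k ∎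
    where
    open ≃-Reasoning
    h = ⌊ k /2⌋

  module _ (r : ℕ → ℝ) (r₀ : r 0 ≃ fromℕ 2) (r₁ : r 1 ≃ s)
    (r-recurrence : ∀ k → r (2 ℕ.+ k) ≃ s * r (1 ℕ.+ k) - r k) where

    -- With `r k` as twice the Chebyshev polynomial of the first kind at `s / 2`, this is the
    -- classical relation between the two kinds.
    first-kind : ∀ k → r (2 ℕ.+ k) ≃ U (2 ℕ.+ k) - U k
    first-kind k = R.trans (r-suc (suc k)) (R.trans
      (R.+-congʳ (R.trans
        (solve 1 (λ u → con (+ 2 / 1) :* u := u :+ u) R.refl (U (2 ℕ.+ k)))
        (R.+-congˡ (U-recurrence k))))
      (solve 3 (λ v u w → v :+ (w :- u) :- w := v :- u) R.refl (U (2 ℕ.+ k)) (U k) (s * U (1 ℕ.+ k))))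
      where
      -- This form needs no `U` at a negative index. Its right-hand side solves the recurrence of
      -- `r`, so agreement at the two initial indices suffices.
      r-suc : ∀ k → r (1 ℕ.+ k) ≃ fromℕ 2 * U (1 ℕ.+ k) - s * U k
      r-suc zero = begin
        r 1                           ≈⟨ r₁ ⟩
        s                             ≈⟨ solve 1 (λ s → s := con (+ 2 / 1) :* s :- s :* con 1ℚ) R.refl s ⟩
        fromℕ 2 * s - s * 1ℝ          ≈⟨ R.+-cong (R.*-congˡ U-one) (R.-‿cong (R.*-congˡ U-zero)) ⟨
        fromℕ 2 * U 1 - s * U 0       ∎
        where open ≃-Reasoning
      r-suc (suc zero) = begin
        r 2                                   ≈⟨ r-recurrence 0 ⟩
        s * r 1 - r 0                         ≈⟨ R.+-cong (R.*-congˡ r₁) (R.-‿cong r₀) ⟩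
        s * s - fromℕ 2                       ≈⟨ solve 1 (λ s → s :* s :- con (+ 2 / 1) := con (+ 2 / 1) :* (s :* s :- con 1ℚ) :- s :* s) R.refl s ⟩
        fromℕ 2 * (s * s - 1ℝ) - s * s        ≈⟨ R.+-cong (R.*-congˡ (R.+-cong (R.*-congˡ U-one) (R.-‿cong U-zero))) (R.-‿cong (R.*-congˡ U-one)) ⟨
        fromℕ 2 * (s * U 1 - U 0) - s * U 1   ≈⟨ R.+-congʳ (R.*-congˡ (U-recurrence 0)) ⟨
        fromℕ 2 * U 2 - s * U 1               ∎
        where open ≃-Reasoning
      r-suc (suc (suc k)) = begin
        r (3 ℕ.+ k)
          ≈⟨ r-recurrence (suc k) ⟩
        s * r (2 ℕ.+ k) - r (1 ℕ.+ k)
          ≈⟨ R.+-cong (R.*-congˡ (r-suc (suc k))) (R.-‿cong (r-suc k)) ⟩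
        s * (fromℕ 2 * U (2 ℕ.+ k) - s * U (1 ℕ.+ k)) - (fromℕ 2 * U (1 ℕ.+ k) - s * U k)
          ≈⟨ solve 4 (λ s u₀ u₁ u₂ →
               s :* (con (+ 2 / 1) :* u₂ :- s :* u₁) :- (con (+ 2 / 1) :* u₁ :- s :* u₀) :=
               con (+ 2 / 1) :* (s :* u₂ :- u₁) :- s :* (s :* u₁ :- u₀))
               R.refl s (U k) (U (1 ℕ.+ k)) (U (2 ℕ.+ k)) ⟩
        fromℕ 2 * (s * U (2 ℕ.+ k) - U (1 ℕ.+ k)) - s * (s * U (1 ℕ.+ k) - U k)
          ≈⟨ R.+-cong (R.*-congˡ (U-recurrence (suc k))) (R.-‿cong (R.*-congˡ (U-recurrence k))) ⟨
        fromℕ 2 * U (3 ℕ.+ k) - s * U (2 ℕ.+ k) ∎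
        where open ≃-Reasoning

    closed-form : ∀ k → 1 ≤ k → r k ≃ closedForm k
    -- Here the sum is empty; `first-kind` takes over from index 2.
    closed-form (suc zero)    _ = R.trans r₁ (solve 1 (λ s → s := s :* con 1ℚ :+ con (+ 1 / 1) :* con 0ℚ) R.refl s)
    closed-form (suc (suc k)) _ = R.trans (first-kind k) (R.sym (closedForm-U k))

-- Linear recurrences with periodic coefficients

-- For periodic `b` this is a discrete Hill equation. The coefficient -1 of `z t` is what keeps the
-- Wronskian constant.
Solves : (b z : ℕ → ℝ) → Set
Solves b z = ∀ t → z (2 ℕ.+ t) ≃ b t * z (1 ℕ.+ t) - z t

module Monodromy
  (b : ℕ → ℝ) (n : ℕ) (b-periodic : ∀ t → b (t ℕ.+ n) ≃ b t)
  (x y : ℕ → ℝ) (x-solves : Solves b x) (y-solves : Solves b y)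
  (x₀ : x 0 ≃ 0ℝ) (x₁ : x 1 ≃ 1ℝ) (y₀ : y 0 ≃ - 1ℝ) (y₁ : y 1 ≃ 0ℝ)
  where

  -- One step of the recurrence is a matrix of determinant 1. At `t = n` the left-hand side is minus
  -- the determinant of the monodromy matrix.
  wronskian : ∀ t → x (1 ℕ.+ t) * y t - x t * y (1 ℕ.+ t) ≃ - 1ℝ
  wronskian zero    = begin
    x 1 * y 0 - x 0 * y 1      ≈⟨ R.+-cong (R.*-cong x₁ y₀) (R.-‿cong (R.*-cong x₀ y₁)) ⟩
    1ℝ * - 1ℝ - 0ℝ * 0ℝ        ≈⟨ solve 0 (con 1ℚ :* :- con 1ℚ :- con 0ℚ :* con 0ℚ := :- con 1ℚ) R.refl ⟩
    - 1ℝ                       ∎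
    where open ≃-Reasoning
  wronskian (suc t) = begin
    x (2 ℕ.+ t) * y (1 ℕ.+ t) - x (1 ℕ.+ t) * y (2 ℕ.+ t)
      ≈⟨ R.+-cong (R.*-congʳ (x-solves t)) (R.-‿cong (R.*-congˡ (y-solves t))) ⟩
    (b t * x (1 ℕ.+ t) - x t) * y (1 ℕ.+ t) - x (1 ℕ.+ t) * (b t * y (1 ℕ.+ t) - y t)
      ≈⟨ solve 5 (λ b x x′ y y′ → (b :* x′ :- x) :* y′ :- x′ :* (b :* y′ :- y) := x′ :* y :- x :* y′)
           R.refl (b t) (x t) (x (1 ℕ.+ t)) (y t) (y (1 ℕ.+ t)) ⟩
    x (1 ℕ.+ t) * y t - x t * y (1 ℕ.+ t)
      ≈⟨ wronskian t ⟩
    - 1ℝ ∎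
    where open ≃-Reasoning

  -- Both sides solve the recurrence and agree at 0 and 1; the minus sign compensates `y 0 ≃ - 1ℝ`.
  spanned : ∀ z → Solves b z → ∀ t → z t ≃ z 1 * x t - z 0 * y t
  spanned z z-solves zero = begin
    z 0                              ≈⟨ solve 2 (λ z₀ z₁ → z₀ := z₁ :* con 0ℚ :- z₀ :* :- con 1ℚ) R.refl (z 0) (z 1) ⟩
    z 1 * 0ℝ - z 0 * - 1ℝ            ≈⟨ R.+-cong (R.*-congˡ x₀) (R.-‿cong (R.*-congˡ y₀)) ⟨
    z 1 * x 0 - z 0 * y 0            ∎
    where open ≃-Reasoning
  spanned z z-solves (suc zero) = begin
    z 1                              ≈⟨ solve 2 (λ z₀ z₁ → z₁ := z₁ :* con 1ℚ :- z₀ :* con 0ℚ) R.refl (z 0) (z 1) ⟩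
    z 1 * 1ℝ - z 0 * 0ℝ              ≈⟨ R.+-cong (R.*-congˡ x₁) (R.-‿cong (R.*-congˡ y₁)) ⟨
    z 1 * x 1 - z 0 * y 1            ∎
    where open ≃-Reasoning
  spanned z z-solves (suc (suc t)) = begin
    z (2 ℕ.+ t)
      ≈⟨ z-solves t ⟩
    b t * z (1 ℕ.+ t) - z t
      ≈⟨ R.+-cong (R.*-congˡ (spanned z z-solves (suc t))) (R.-‿cong (spanned z z-solves t)) ⟩
    b t * (z 1 * x (1 ℕ.+ t) - z 0 * y (1 ℕ.+ t)) - (z 1 * x t - z 0 * y t)
      ≈⟨ solve 7 (λ b z₀ z₁ x x′ y y′ →
           b :* (z₁ :* x′ :- z₀ :* y′) :- (z₁ :* x :- z₀ :* y) :=
           z₁ :* (b :* x′ :- x) :- z₀ :* (b :* y′ :- y))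
           R.refl (b t) (z 0) (z 1) (x t) (x (1 ℕ.+ t)) (y t) (y (1 ℕ.+ t)) ⟩
    z 1 * (b t * x (1 ℕ.+ t) - x t) - z 0 * (b t * y (1 ℕ.+ t) - y t)
      ≈⟨ R.+-cong (R.*-congˡ (x-solves t)) (R.-‿cong (R.*-congˡ (y-solves t))) ⟨
    z 1 * x (2 ℕ.+ t) - z 0 * y (2 ℕ.+ t) ∎
    where open ≃-Reasoning

  b-multiperiodic : ∀ k t → b (t ℕ.+ k ℕ.* n) ≃ b t
  b-multiperiodic zero    t = R.reflexive (cong b (ℕₚ.+-identityʳ t))
  b-multiperiodic (suc k) t = begin
    b (t ℕ.+ (n ℕ.+ k ℕ.* n))   ≡⟨ cong b (ℕₚ.+-assoc t n (k ℕ.* n)) ⟨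
    b (t ℕ.+ n ℕ.+ k ℕ.* n)     ≈⟨ b-multiperiodic k (t ℕ.+ n) ⟩
    b (t ℕ.+ n)                 ≈⟨ b-periodic t ⟩
    b t                         ∎
    where open ≃-Reasoning

  -- By periodicity of `b`, the translate of a solution is a solution, and its two initial values
  -- are its coordinates in the basis `x`, `- y`. For `z` equal to `x` or `y` these are, up to sign,
  -- the entries of a power of the monodromy matrix.
  shifted : ∀ z → Solves b z → ∀ k t →
    z (t ℕ.+ k ℕ.* n) ≃ z (1 ℕ.+ k ℕ.* n) * x t - z (k ℕ.* n) * y t
  shifted z z-solves k = spanned (λ t → z (t ℕ.+ k ℕ.* n)) λ t → R.trans
    (z-solves (t ℕ.+ k ℕ.* n))
    (R.+-congʳ (R.*-congʳ (b-multiperiodic k t)))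

  -- The trace of the k-th power of the monodromy matrix.
  trace : ℕ → ℝ
  trace k = x (1 ℕ.+ k ℕ.* n) - y (k ℕ.* n)

  trace-zero : trace 0 ≃ fromℕ 2
  trace-zero = R.trans (R.+-cong x₁ (R.-‿cong y₀))
    (solve 0 (con 1ℚ :- (:- con 1ℚ) := con (+ 2 / 1)) R.refl)

  -- Cayley-Hamilton in coordinates. The monodromy matrix has trace `P - T` and determinant
  -- `R′ * Q - P * T`, which is 1.
  trace-recurrence : ∀ k → trace (2 ℕ.+ k) ≃ trace 1 * trace (1 ℕ.+ k) - trace k
  trace-recurrence k = begin
    trace (2 ℕ.+ k)
      ≈⟨ R.+-cong (shifted x x-solves (suc k) (suc n)) (R.-‿cong (shifted y y-solves (suc k) n)) ⟩
    (X′ * P - X″ * Q) - (Y′ * R′ - Y″ * T)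
      -- The product of traces is split off. In the remainder, the entries for `suc k` periods are
      -- expanded once more through those for `k` periods, and the Wronskian at `n` factors out.
      ≈⟨ solve 8 (λ P Q R T X′ X″ Y′ Y″ →
           (X′ :* P :- X″ :* Q) :- (Y′ :* R :- Y″ :* T) :=
           (P :- T) :* (X′ :- Y″) :+ ((T :* X′ :- X″ :* Q) :- (Y′ :* R :- P :* Y″)))
           R.refl P Q R′ T X′ X″ Y′ Y″ ⟩
    (P - T) * (X′ - Y″) + ((T * X′ - X″ * Q) - (Y′ * R′ - P * Y″))
      ≈⟨ R.+-congˡ (R.+-cong
           (R.+-cong (R.*-congˡ (shifted x x-solves k (suc n))) (R.-‿cong (R.*-congʳ (shifted x x-solves k n))))
           (R.-‿cong (R.+-cong (R.*-congʳ (shifted y y-solves k (suc n))) (R.-‿cong (R.*-congˡ (shifted y y-solves k n)))))) ⟩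
    (P - T) * (X′ - Y″) + ((T * (X * P - X₀ * Q) - (X * R′ - X₀ * T) * Q)
      - ((Y * P - Y₀ * Q) * R′ - P * (Y * R′ - Y₀ * T)))
      ≈⟨ solve 10 (λ P Q R T X X₀ Y Y₀ X′ Y″ →
           (P :- T) :* (X′ :- Y″) :+ ((T :* (X :* P :- X₀ :* Q) :- (X :* R :- X₀ :* T) :* Q)
             :- ((Y :* P :- Y₀ :* Q) :* R :- P :* (Y :* R :- Y₀ :* T))) :=
           (P :- T) :* (X′ :- Y″) :+ (X :- Y₀) :* (P :* T :- R :* Q))
           R.refl P Q R′ T X X₀ Y Y₀ X′ Y″ ⟩
    (P - T) * (X′ - Y″) + (X - Y₀) * (P * T - R′ * Q)
      ≈⟨ R.+-cong (R.*-congʳ (R.sym trace-one)) (R.*-congˡ (wronskian n)) ⟩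
    trace 1 * trace (1 ℕ.+ k) + trace k * - 1ℝ
      ≈⟨ solve 2 (λ u v → u :+ v :* :- con 1ℚ := u :- v) R.refl (trace 1 * trace (1 ℕ.+ k)) (trace k) ⟩
    trace 1 * trace (1 ℕ.+ k) - trace k ∎
    where
    open ≃-Reasoning
    P  = x (suc n)
    Q  = y (suc n)
    R′ = x n
    T  = y n
    X  = x (1 ℕ.+ k ℕ.* n)
    X₀ = x (k ℕ.* n)
    Y  = y (1 ℕ.+ k ℕ.* n)
    Y₀ = y (k ℕ.* n)
    X′ = x (1 ℕ.+ suc k ℕ.* n)
    X″ = x (suc k ℕ.* n)
    Y′ = y (1 ℕ.+ suc k ℕ.* n)
    Y″ = y (suc k ℕ.* n)
    trace-one : trace 1 ≃ P - T
    trace-one = R.reflexive (cong (λ t → x (suc t) - y t) (ℕₚ.*-identityˡ n))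

-- Recurrences in a tame frieze

-- Iterated `+ 1` matches the one-column shifts in the minors definitionally.
columns : ℤ → Fin 3 → ℤ
columns i 0F = i
columns i 1F = i ℤ.+ + 1
columns i 2F = i ℤ.+ + 1 ℤ.+ + 1

-- A frieze in the coordinates g i t = m i (i + t - 2), where t numbers the rows
-- and Row t says that row t belongs to the array.
record TameGrid (Row : ℕ → Set) (g : ℤ → ℕ → ℝ) : Set where
  field
    row-≤   : ∀ {s t} → s ≤ t → Row t → Row s
    g-zero  : ∀ i → g i 0 ≃ 0ℝ
    g-one   : ∀ i → g i 1 ≃ 1ℝ
    g-unimodular : ∀ i t → Row (2 ℕ.+ t) →
      g i (1 ℕ.+ t) * g (i ℤ.+ + 1) (1 ℕ.+ t) - g i (2 ℕ.+ t) * g (i ℤ.+ + 1) t ≃ 1ℝ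
    -- At fixed `j`, moving one column on lowers the row number by one; hence the offset
    -- `2 ∸ toℕ c`.
    g-tame : ∀ i t → Row (4 ℕ.+ t) →
      det₃ (λ r c → g (columns i c) (toℕ r ℕ.+ (2 ∸ toℕ c) ℕ.+ t)) ≃ 0ℝ

module Grid {Row : ℕ → Set} {g : ℤ → ℕ → ℝ} (grid : TameGrid Row g) where

  open TameGrid grid public

  quiddity : ℤ → ℝ
  quiddity i = g i 2

  -- The minor of two adjacent columns on the outer two of three consecutive rows of the matrix: up
  -- to sign, the middle coordinate of their cross product. It becomes the coefficient of the
  -- recurrence.
  slope : ℤ → ℕ → ℝ
  slope i t = g i (1 ℕ.+ t) * g (i ℤ.+ + 1) (2 ℕ.+ t) - g i (3 ℕ.+ t) * g (i ℤ.+ + 1) t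

  -- For the columns u, v, w of the matrix, u × v and v × w are parallel since
  -- their cross product is det · v; both have outer coordinates 1.
  slope-step : ∀ i t → Row (4 ℕ.+ t) → slope i (1 ℕ.+ t) ≃ slope (i ℤ.+ + 1) t
  slope-step i t row = begin
    p                                     ≈⟨ R.*-identityʳ p ⟨
    p * 1ℝ                                ≈⟨ R.*-congˡ (g-unimodular (i ℤ.+ + 1) (1 ℕ.+ t) (row-≤ (ℕₚ.n≤1+n (3 ℕ.+ t)) row)) ⟨
    p * (v₁ * w₂ - v₂ * w₁)               ≈⟨ solve 9 (λ u₀ u₁ u₂ v₀ v₁ v₂ w₀ w₁ w₂ →
        (u₀ :* v₂ :- u₂ :* v₀) :* (v₁ :* w₂ :- v₂ :* w₁) :=
        (v₀ :* w₂ :- v₂ :* w₀) :* (u₁ :* v₂ :- u₂ :* v₁) :+ v₂ :*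
          (u₀ :* (v₁ :* w₂ :- w₁ :* v₂) :- v₀ :* (u₁ :* w₂ :- w₁ :* u₂) :+ w₀ :* (u₁ :* v₂ :- v₁ :* u₂)))
        R.refl u₀ u₁ u₂ v₀ v₁ v₂ w₀ w₁ w₂ ⟩
    q * (u₁ * v₂ - u₂ * v₁) + v₂ * _      ≈⟨ R.+-cong (R.*-congˡ (g-unimodular i (2 ℕ.+ t) row)) (R.*-congˡ (g-tame i t row)) ⟩
    q * 1ℝ + v₂ * 0ℝ                      ≈⟨ solve 2 (λ q v → q :* con 1ℚ :+ v :* con 0ℚ := q) R.refl q v₂ ⟩
    q                                     ∎
    where
    open ≃-Reasoning
    u₀ = g i (2 ℕ.+ t)
    u₁ = g i (3 ℕ.+ t)
    u₂ = g i (4 ℕ.+ t)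
    v₀ = g (i ℤ.+ + 1) (1 ℕ.+ t)
    v₁ = g (i ℤ.+ + 1) (2 ℕ.+ t)
    v₂ = g (i ℤ.+ + 1) (3 ℕ.+ t)
    w₀ = g (i ℤ.+ + 1 ℤ.+ + 1) t
    w₁ = g (i ℤ.+ + 1 ℤ.+ + 1) (1 ℕ.+ t)
    w₂ = g (i ℤ.+ + 1 ℤ.+ + 1) (2 ℕ.+ t)
    p = slope i (1 ℕ.+ t)
    q = slope (i ℤ.+ + 1) t

  -- `slope-step` descends at fixed `j` to `t = 0`, where the rows of zeros and ones leave a single
  -- quiddity entry.
  slope-quiddity : ∀ i t → Row (3 ℕ.+ t) → slope i t ≃ quiddity (i ℤ.+ + suc t)
  slope-quiddity i zero row = begin
    g i 1 * g (i ℤ.+ + 1) 2 - g i 3 * g (i ℤ.+ + 1) 0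
      ≈⟨ R.+-cong (R.*-congʳ (g-one i)) (R.-‿cong (R.*-congˡ (g-zero (i ℤ.+ + 1)))) ⟩
    1ℝ * g (i ℤ.+ + 1) 2 - g i 3 * 0ℝ
      ≈⟨ solve 2 (λ u v → con 1ℚ :* u :- v :* con 0ℚ := u) R.refl (g (i ℤ.+ + 1) 2) (g i 3) ⟩
    quiddity (i ℤ.+ + 1) ∎
    where open ≃-Reasoning
  slope-quiddity i (suc t) row = begin
    slope i (suc t)                         ≈⟨ slope-step i t row ⟩
    slope (i ℤ.+ + 1) t                     ≈⟨ slope-quiddity (i ℤ.+ + 1) t (row-≤ (ℕₚ.n≤1+n (3 ℕ.+ t)) row) ⟩
    quiddity (i ℤ.+ + 1 ℤ.+ + suc t)        ≡⟨ cong quiddity (ℤₚ.+-assoc i (+ 1) (+ suc t)) ⟩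
    quiddity (i ℤ.+ + suc (suc t))          ∎
    where open ≃-Reasoning

  Recurrence : ℕ → Set
  Recurrence t = ∀ i → g i (2 ℕ.+ t) ≃ quiddity (i ℤ.+ + t) * g i (1 ℕ.+ t) - g i t

  -- A Plücker relation among the minors of two adjacent columns: those on adjacent rows are 1, and
  -- the outer one is `slope`.
  recurrence : ∀ t → Row (2 ℕ.+ t) → Recurrence t
  recurrence zero row i = begin
    quiddity i                                       ≡⟨ cong quiddity (ℤₚ.+-identityʳ i) ⟨
    quiddity (i ℤ.+ + 0)                             ≈⟨ solve 1 (λ a → a := a :* con 1ℚ :- con 0ℚ) R.refl (quiddity (i ℤ.+ + 0)) ⟩
    quiddity (i ℤ.+ + 0) * 1ℝ - 0ℝ                   ≈⟨ R.+-cong (R.*-congˡ (g-one i)) (R.-‿cong (g-zero i)) ⟨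
    quiddity (i ℤ.+ + 0) * g i 1 - g i 0             ∎
    where open ≃-Reasoning
  recurrence (suc t) row i = begin
    u₂
      ≈⟨ solve 1 (λ u → u := u :* con 1ℚ) R.refl u₂ ⟩
    u₂ * 1ℝ
      ≈⟨ R.*-congˡ (g-unimodular i t (row-≤ (ℕₚ.n≤1+n (2 ℕ.+ t)) row)) ⟨
    u₂ * (u₀ * v₁ - u₁ * v₀)
      ≈⟨ solve 6 (λ u₀ u₁ u₂ v₀ v₁ v₂ →
           u₂ :* (u₀ :* v₁ :- u₁ :* v₀) :=
           (u₀ :* v₂ :- u₂ :* v₀) :* u₁ :- u₀ :* (u₁ :* v₂ :- u₂ :* v₁))
           R.refl u₀ u₁ u₂ v₀ v₁ v₂ ⟩
    slope i t * u₁ - u₀ * (u₁ * v₂ - u₂ * v₁)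
      ≈⟨ R.+-cong (R.*-congʳ (slope-quiddity i t row)) (R.-‿cong (R.*-congˡ (g-unimodular i (suc t) row))) ⟩
    quiddity (i ℤ.+ + suc t) * u₁ - u₀ * 1ℝ
      ≈⟨ R.+-congˡ (R.-‿cong (R.*-identityʳ u₀)) ⟩
    quiddity (i ℤ.+ + suc t) * u₁ - u₀ ∎
    where
    open ≃-Reasoning
    u₀ = g i (1 ℕ.+ t)
    u₁ = g i (2 ℕ.+ t)
    u₂ = g i (3 ℕ.+ t)
    v₀ = g (i ℤ.+ + 1) t
    v₁ = g (i ℤ.+ + 1) (1 ℕ.+ t)
    v₂ = g (i ℤ.+ + 1) (2 ℕ.+ t)

  -- Two-step induction on `t`. The coefficient of `recurrence` depends only on `i + t`, so the
  -- three columns involved share it and both sides obey the same recurrence.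
  dual-recurrence : ∀ t i → Row (2 ℕ.+ t) →
    g i (2 ℕ.+ t) ≃ quiddity i * g (i ℤ.+ + 1) (1 ℕ.+ t) - g (i ℤ.+ + 1 ℤ.+ + 1) t
  dual-recurrence zero i row = begin
    quiddity i                                                ≈⟨ solve 1 (λ a → a := a :* con 1ℚ :- con 0ℚ) R.refl (quiddity i) ⟩
    quiddity i * 1ℝ - 0ℝ                                      ≈⟨ R.+-cong (R.*-congˡ (g-one (i ℤ.+ + 1))) (R.-‿cong (g-zero (i ℤ.+ + 1 ℤ.+ + 1))) ⟨
    quiddity i * g (i ℤ.+ + 1) 1 - g (i ℤ.+ + 1 ℤ.+ + 1) 0    ∎
    where open ≃-Reasoning
  dual-recurrence (suc zero) i row = begin
    g i 3                                                     ≈⟨ recurrence 1 row i ⟩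
    quiddity (i ℤ.+ + 1) * quiddity i - g i 1                 ≈⟨ R.+-cong
      (R.*-comm (quiddity (i ℤ.+ + 1)) (quiddity i))
      (R.-‿cong (R.trans (g-one i) (R.sym (g-one (i ℤ.+ + 1 ℤ.+ + 1))))) ⟩
    quiddity i * g (i ℤ.+ + 1) 2 - g (i ℤ.+ + 1 ℤ.+ + 1) 1    ∎
    where open ≃-Reasoning
  dual-recurrence (suc (suc t)) i row = begin
    g i (4 ℕ.+ t)
      ≈⟨ recurrence (2 ℕ.+ t) row i ⟩
    a * g i (3 ℕ.+ t) - g i (2 ℕ.+ t)
      ≈⟨ R.+-cong (R.*-congˡ (dual-recurrence (suc t) i row′)) (R.-‿cong (dual-recurrence t i row″)) ⟩
    a * (b * v₂ - w₁) - (b * v₁ - w₀)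
      ≈⟨ solve 6 (λ a b v₁ v₂ w₀ w₁ → a :* (b :* v₂ :- w₁) :- (b :* v₁ :- w₀) := b :* (a :* v₂ :- v₁) :- (a :* w₁ :- w₀))
           R.refl a b v₁ v₂ w₀ w₁ ⟩
    b * (a * v₂ - v₁) - (a * w₁ - w₀)
      ≡⟨ cong₂ (λ c d → b * (quiddity c * v₂ - v₁) - (quiddity d * w₁ - w₀))
           (sym (ℤₚ.+-assoc i (+ 1) (+ suc t)))
           (sym (trans (ℤₚ.+-assoc (i ℤ.+ + 1) (+ 1) (+ t)) (ℤₚ.+-assoc i (+ 1) (+ suc t)))) ⟩
    b * (quiddity (i ℤ.+ + 1 ℤ.+ + suc t) * v₂ - v₁) - (quiddity (i ℤ.+ + 1 ℤ.+ + 1 ℤ.+ + t) * w₁ - w₀)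
      ≈⟨ R.+-cong (R.*-congˡ (recurrence (suc t) row′ (i ℤ.+ + 1))) (R.-‿cong (recurrence t row″ (i ℤ.+ + 1 ℤ.+ + 1))) ⟨
    b * g (i ℤ.+ + 1) (3 ℕ.+ t) - g (i ℤ.+ + 1 ℤ.+ + 1) (2 ℕ.+ t) ∎
    where
    open ≃-Reasoning
    a = quiddity (i ℤ.+ + (2 ℕ.+ t))
    b = quiddity i
    v₁ = g (i ℤ.+ + 1) (1 ℕ.+ t)
    v₂ = g (i ℤ.+ + 1) (2 ℕ.+ t)
    w₀ = g (i ℤ.+ + 1 ℤ.+ + 1) t
    w₁ = g (i ℤ.+ + 1 ℤ.+ + 1) (1 ℕ.+ t)
    row′ = row-≤ (ℕₚ.n≤1+n (3 ℕ.+ t)) row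
    row″ = row-≤ (ℕₚ.n≤1+n (2 ℕ.+ t)) row′

-- Finite friezes: the recurrence across the mirrors.

-- Rows of a lattice whose mirrors are the rows 0, 2 + M, 2 (2 + M), ...
data RowPosition (M : ℕ) : ℕ → Set where
  below        : ∀ {t} → t ≤ M → RowPosition M t
  at-mirror    : RowPosition M (1 ℕ.+ M)
  reflected    : ∀ t u → t ℕ.+ u ≡ M → RowPosition M (2 ℕ.+ M ℕ.+ t)
  at-mirror²   : RowPosition M (2 ℕ.+ M ℕ.+ (1 ℕ.+ M))
  translated   : ∀ t → RowPosition M (2 ℕ.+ M ℕ.+ (2 ℕ.+ M ℕ.+ t))

rowPosition : ∀ M t → RowPosition M t
rowPosition M t with ℕ.compare t (suc M)
... | ℕ.less .t k  = below (ℕₚ.m≤m+n t k)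
... | ℕ.equal .t   = at-mirror
... | ℕ.greater _ t′ with ℕ.compare t′ (suc M)
...   | ℕ.less .t′ u     = reflected t′ u refl
...   | ℕ.equal .t′      = at-mirror²
...   | ℕ.greater _ t″   = translated t″

module FiniteGrid {M : ℕ} {g : ℤ → ℕ → ℝ} (grid : TameGrid (_≤ 2 ℕ.+ M) g)
  (g-top-one  : ∀ i → g i (1 ℕ.+ M) ≃ 1ℝ)
  (g-top-zero : ∀ i → g i (2 ℕ.+ M) ≃ 0ℝ)
  (g-reflect : ∀ i t u → t ℕ.+ u ≡ 2 ℕ.+ M → g i (2 ℕ.+ M ℕ.+ t) ≃ - g (i ℤ.+ + t) u)
  (g-translate : ∀ i t → g i (2 ℕ.+ M ℕ.+ (2 ℕ.+ M ℕ.+ t)) ≃ g (i ℤ.+ + (2 ℕ.+ M)) t)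
  where

  open Grid grid

  -- In the top row of zeros, the dual recurrence in column `i` and the recurrence in column `i″`
  -- express both quiddity entries as the same entry `w`.
  quiddity-periodic : ∀ i → quiddity (i ℤ.+ + (2 ℕ.+ M)) ≃ quiddity i
  quiddity-periodic i = R.sym (begin
    b
      ≈⟨ solve 2 (λ b w → b := (b :* con 1ℚ :- w) :+ w) R.refl b w ⟩
    (b * 1ℝ - w) + w
      ≈⟨ R.+-congʳ (R.+-congʳ (R.*-congˡ (g-top-one (i ℤ.+ + 1)))) ⟨
    (b * g (i ℤ.+ + 1) (1 ℕ.+ M) - w) + w
      ≈⟨ R.+-congʳ (R.trans (R.sym (dual-recurrence M i ℕₚ.≤-refl)) (R.trans (g-top-zero i) (R.sym (g-top-zero i″)))) ⟩
    g i″ (2 ℕ.+ M) + w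
      ≈⟨ R.+-congʳ (R.trans (recurrence M ℕₚ.≤-refl i″) (R.+-congʳ (R.*-congˡ (g-top-one i″)))) ⟩
    (quiddity (i″ ℤ.+ + M) * 1ℝ - w) + w
      ≈⟨ solve 2 (λ b w → (b :* con 1ℚ :- w) :+ w := b) R.refl (quiddity (i″ ℤ.+ + M)) w ⟩
    quiddity (i″ ℤ.+ + M)
      ≡⟨ cong quiddity (trans (ℤₚ.+-assoc (i ℤ.+ + 1) (+ 1) (+ M)) (ℤₚ.+-assoc i (+ 1) (+ suc M))) ⟩
    quiddity (i ℤ.+ + (2 ℕ.+ M)) ∎)
    where
    open ≃-Reasoning
    i″ = i ℤ.+ + 1 ℤ.+ + 1
    b = quiddity i
    w = g i″ M

  quiddity-+-N : ∀ i t → quiddity (i ℤ.+ + (2 ℕ.+ M ℕ.+ t)) ≃ quiddity (i ℤ.+ + t)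
  quiddity-+-N i t = R.trans
    (R.reflexive (cong quiddity (trans (cong (λ s → i ℤ.+ + s) (ℕₚ.+-comm (2 ℕ.+ M) t)) (sym (ℤₚ.+-assoc i (+ t) (+ (2 ℕ.+ M)))))))
    (quiddity-periodic (i ℤ.+ + t))

  -- Beyond the array the recurrence is reflected to the dual recurrence inside it.
  lattice-recurrence : ∀ t → Recurrence t
  lattice-recurrence = <-rec Recurrence λ t rec → step t rec (rowPosition M t)
    where
    open ≃-Reasoning
    step : ∀ t → (∀ {s} → s < t → Recurrence s) → RowPosition M t → Recurrence t
    step t _ (below t≤M) = recurrence t (s≤s (s≤s t≤M))
    -- Three consecutive rows around a mirror hold 1, 0, -1, or their negatives at `at-mirror²`, so
    -- the recurrence holds there with any coefficient.
    step _ _ at-mirror i = begin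
      g i (3 ℕ.+ M)
        ≡⟨ cong (g i) (ℕₚ.+-comm (2 ℕ.+ M) 1) ⟨
      g i (2 ℕ.+ M ℕ.+ 1)
        ≈⟨ R.trans (g-reflect i 1 (1 ℕ.+ M) refl) (R.-‿cong (g-top-one (i ℤ.+ + 1))) ⟩
      - 1ℝ
        ≈⟨ solve 1 (λ a → :- con 1ℚ := a :* con 0ℚ :- con 1ℚ) R.refl a ⟩
      a * 0ℝ - 1ℝ
        ≈⟨ R.+-cong (R.*-congˡ (g-top-zero i)) (R.-‿cong (g-top-one i)) ⟨
      a * g i (2 ℕ.+ M) - g i (1 ℕ.+ M) ∎
      where a = quiddity (i ℤ.+ + (1 ℕ.+ M))
    step _ _ (reflected t u t+u≡M) i = begin
      g i (2 ℕ.+ (2 ℕ.+ M ℕ.+ t))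
        ≡⟨ cong (g i) (trans (ℕₚ.+-suc (2 ℕ.+ M) (suc t)) (cong suc (ℕₚ.+-suc (2 ℕ.+ M) t))) ⟨
      g i (2 ℕ.+ M ℕ.+ (2 ℕ.+ t))
        ≈⟨ g-reflect i (2 ℕ.+ t) u (cong (2 ℕ.+_) t+u≡M) ⟩
      - g (i ℤ.+ + (2 ℕ.+ t)) u
        ≡⟨ cong (λ j → - g j u) (trans (shift i (1 ℕ.+ t)) (cong (ℤ._+ + 1) (shift i t))) ⟩
      - g (j ℤ.+ + 1 ℤ.+ + 1) u
        ≈⟨ solve 3 (λ a v w → :- w := a :* (:- v) :- (:- (a :* v :- w))) R.refl
             (quiddity j) (g (j ℤ.+ + 1) (1 ℕ.+ u)) (g (j ℤ.+ + 1 ℤ.+ + 1) u) ⟩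
      quiddity j * - g (j ℤ.+ + 1) (1 ℕ.+ u) - - (quiddity j * g (j ℤ.+ + 1) (1 ℕ.+ u) - g (j ℤ.+ + 1 ℤ.+ + 1) u)
        ≈⟨ R.+-cong
             (R.*-cong (R.sym (quiddity-+-N i t)) (R.reflexive (cong (λ k → - g k (1 ℕ.+ u)) (sym (shift i t)))))
             (R.-‿cong (R.-‿cong (R.sym (dual-recurrence u j (s≤s (s≤s (ℕₚ.m+n≤o⇒n≤o t (ℕₚ.≤-reflexive t+u≡M)))))))) ⟩
      a * - g (i ℤ.+ + (1 ℕ.+ t)) (1 ℕ.+ u) - - g j (2 ℕ.+ u)
        ≈⟨ R.+-cong
             (R.*-congˡ (g-reflect i (1 ℕ.+ t) (1 ℕ.+ u) (cong suc (trans (ℕₚ.+-suc t u) (cong suc t+u≡M)))))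
             (R.-‿cong (g-reflect i t (2 ℕ.+ u) (trans (ℕₚ.+-suc t (suc u)) (cong suc (trans (ℕₚ.+-suc t u) (cong suc t+u≡M)))))) ⟨
      a * g i (2 ℕ.+ M ℕ.+ (1 ℕ.+ t)) - g i (2 ℕ.+ M ℕ.+ t)
        ≡⟨ cong (λ s → a * g i s - g i (2 ℕ.+ M ℕ.+ t)) (ℕₚ.+-suc (2 ℕ.+ M) t) ⟩
      a * g i (1 ℕ.+ (2 ℕ.+ M ℕ.+ t)) - g i (2 ℕ.+ M ℕ.+ t) ∎
      where
      j = i ℤ.+ + t
      a = quiddity (i ℤ.+ + (2 ℕ.+ M ℕ.+ t))
      shift : ∀ i t → i ℤ.+ + (1 ℕ.+ t) ≡ i ℤ.+ + t ℤ.+ + 1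
      shift i t = trans (cong (λ s → i ℤ.+ + s) (ℕₚ.+-comm 1 t)) (sym (ℤₚ.+-assoc i (+ t) (+ 1)))
    step _ _ at-mirror² i = begin
      g i (2 ℕ.+ (N ℕ.+ (1 ℕ.+ M)))
        ≡⟨ cong (g i) eq₁ ⟩
      g i (N ℕ.+ (N ℕ.+ 1))
        ≈⟨ R.trans (g-translate i 1) (g-one (i ℤ.+ + N)) ⟩
      1ℝ
        ≈⟨ solve 1 (λ a → con 1ℚ := a :* con 0ℚ :- (:- con 1ℚ)) R.refl a ⟩
      a * 0ℝ - - 1ℝ
        ≈⟨ R.+-cong (R.*-congˡ (R.trans (g-translate i 0) (g-zero (i ℤ.+ + N))))
             (R.-‿cong (R.trans (g-reflect i (1 ℕ.+ M) 1 (ℕₚ.+-comm (1 ℕ.+ M) 1)) (R.-‿cong (g-one (i ℤ.+ + (1 ℕ.+ M)))))) ⟨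
      a * g i (N ℕ.+ (N ℕ.+ 0)) - g i (N ℕ.+ (1 ℕ.+ M))
        ≡⟨ cong (λ s → a * g i s - g i (N ℕ.+ (1 ℕ.+ M))) eq₀ ⟩
      a * g i (1 ℕ.+ (N ℕ.+ (1 ℕ.+ M))) - g i (N ℕ.+ (1 ℕ.+ M)) ∎
      where
      N = 2 ℕ.+ M
      a = quiddity (i ℤ.+ + (N ℕ.+ (1 ℕ.+ M)))
      eq₀ : N ℕ.+ (N ℕ.+ 0) ≡ 1 ℕ.+ (N ℕ.+ (1 ℕ.+ M))
      eq₀ = trans (cong (N ℕ.+_) (ℕₚ.+-identityʳ N)) (ℕₚ.+-suc N (1 ℕ.+ M))
      eq₁ : 2 ℕ.+ (N ℕ.+ (1 ℕ.+ M)) ≡ N ℕ.+ (N ℕ.+ 1)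
      eq₁ = sym (trans (cong (N ℕ.+_) (ℕₚ.+-suc N 0)) (trans (ℕₚ.+-suc N (N ℕ.+ 0)) (cong suc eq₀)))
    -- Only this case calls on the strong induction: the translation lowers the row number by
    -- `N + N`.
    step _ rec (translated t) i = begin
      g i (2 ℕ.+ (N ℕ.+ (N ℕ.+ t)))
        ≡⟨ cong (g i) (trans (eq (suc t)) (cong suc (eq t))) ⟨
      g i (N ℕ.+ (N ℕ.+ (2 ℕ.+ t)))
        ≈⟨ g-translate i (2 ℕ.+ t) ⟩
      g (i ℤ.+ + N) (2 ℕ.+ t)
        ≈⟨ rec (s≤s (ℕₚ.m≤n⇒m≤o+n (1 ℕ.+ M) (ℕₚ.m≤n+m t N))) (i ℤ.+ + N) ⟩
      quiddity (i ℤ.+ + N ℤ.+ + t) * g (i ℤ.+ + N) (1 ℕ.+ t) - g (i ℤ.+ + N) t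
        ≈⟨ R.+-cong
             (R.*-cong (R.trans (quiddity-+-N i (N ℕ.+ t)) (R.reflexive (cong quiddity (sym (ℤₚ.+-assoc i (+ N) (+ t)))))) (g-translate i (1 ℕ.+ t)))
             (R.-‿cong (g-translate i t)) ⟨
      a * g i (N ℕ.+ (N ℕ.+ (1 ℕ.+ t))) - g i (N ℕ.+ (N ℕ.+ t))
        ≡⟨ cong (λ s → a * g i s - g i (N ℕ.+ (N ℕ.+ t))) (eq t) ⟩
      a * g i (1 ℕ.+ (N ℕ.+ (N ℕ.+ t))) - g i (N ℕ.+ (N ℕ.+ t)) ∎
      where
      N = 2 ℕ.+ M
      a = quiddity (i ℤ.+ + (N ℕ.+ (N ℕ.+ t)))
      eq : ∀ t → N ℕ.+ (N ℕ.+ (1 ℕ.+ t)) ≡ 1 ℕ.+ (N ℕ.+ (N ℕ.+ t))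
      eq t = trans (cong (N ℕ.+_) (ℕₚ.+-suc N t)) (ℕₚ.+-suc N (N ℕ.+ t))

-- The lattice of a frieze

Row : Shape → ℕ → Set
Row infinite     t = ⊤
Row (finite N _) t = t ≤ N

row-mono : ∀ σ {s t} → s ≤ t → Row σ t → Row σ s
row-mono infinite     _   _   = tt
row-mono (finite N _) s≤t t≤N = ℕₚ.≤-trans s≤t t≤N

row-two : ∀ σ → Row σ 2
row-two infinite       = tt
row-two (finite _ 3≤N) = ℕₚ.≤-trans (ℕₚ.n≤1+n 2) 3≤N

-- `j` is fixed only by an equation, because the frieze conditions write the same position in
-- several arithmetic forms.
inArray : ∀ σ {i j} t → Row σ t → j ≡ i ℤ.+ + t ℤ.- + 2 → InArray σ i j
inArray σ {i} t row refl = in-row σ row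
  where
  offset : i ℤ.+ + t ℤ.- + 2 ℤ.- i ≡ + t ℤ.- + 2
  offset = solveᶻ 2 (λ i t → i ⊕ t ⊖ κ (+ 2) ⊖ i ⊜ t ⊖ κ (+ 2)) refl i (+ t)
  lower : ℤ.- + 2 ℤ.≤ i ℤ.+ + t ℤ.- + 2 ℤ.- i
  lower = subst (ℤ.- + 2 ℤ.≤_) (sym offset) (ℤₚ.+-monoˡ-≤ (ℤ.- + 2) (ℤ.+≤+ (z≤n {t})))
  in-row : ∀ σ → Row σ t → InArray σ i (i ℤ.+ + t ℤ.- + 2)
  in-row infinite     _   = lower
  in-row (finite N _) t≤N = lower ,
    subst (ℤ._≤ + N ℤ.- + 2) (sym offset) (ℤₚ.+-monoˡ-≤ (ℤ.- + 2) (ℤ.+≤+ t≤N))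

det₃-cong : ∀ a b → (∀ r c → a r c ≃ b r c) → det₃ a ≃ det₃ b
det₃-cong a b a≃b = R.+-cong (R.+-cong
  (R.*-cong (a≃b 0F 0F) (minor 1F 2F))
  (R.-‿cong (R.*-cong (a≃b 0F 1F) (minor 0F 2F))))
  (R.*-cong (a≃b 0F 2F) (minor 0F 1F))
  where
  minor : ∀ c d → a 1F c * a 2F d - a 1F d * a 2F c ≃ b 1F c * b 2F d - b 1F d * b 2F c
  minor c d = R.+-cong (R.*-cong (a≃b 1F c) (a≃b 2F d)) (R.-‿cong (R.*-cong (a≃b 1F d) (a≃b 2F c)))

rows : (ℤ → ℤ → ℝ) → ℤ → ℕ → ℝ
rows m i t = m i (i ℤ.+ + t ℤ.- + 2)

module Lattice (F : Frieze) (tame : Tame F) (m : ℤ → ℤ → ℝ) (lat : IsLattice F m) where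

  entry≃rows : ∀ {i i′ j} t .(p : InArray (shape F) i j) → i′ ≡ i → j ≡ i′ ℤ.+ + t ℤ.- + 2 →
    entry F i j p ≃ rows m i′ t
  entry≃rows t p refl refl = R.sym (extends lat _ _ p)

  grid : TameGrid (Row (shape F)) (rows m)
  grid = record
    { row-≤        = row-mono (shape F)
    ; g-zero       = λ i → R.trans (R.sym (entry≃rows 0 (p₀ i) refl (e₀ i))) (zeros F i (p₀ i))
    ; g-one        = λ i → R.trans (R.sym (entry≃rows 1 (p₁ i) refl (e₁ i))) (ones F i (p₁ i))
    ; g-unimodular = g-unimodular
    ; g-tame       = g-tame
    }
    where
    e₀ : ∀ i → i ℤ.- + 2 ≡ i ℤ.+ + 0 ℤ.- + 2
    e₀ i = cong (ℤ._- + 2) (sym (ℤₚ.+-identityʳ i))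
    p₀ : ∀ i → InArray (shape F) i (i ℤ.- + 2)
    p₀ i = inArray (shape F) 0 (row-mono (shape F) z≤n (row-two (shape F))) (e₀ i)
    e₁ : ∀ i → i ℤ.- + 1 ≡ i ℤ.+ + 1 ℤ.- + 2
    e₁ = solveᶻ 1 (λ i → i ⊖ κ (+ 1) ⊜ i ⊕ κ (+ 1) ⊖ κ (+ 2)) refl
    p₁ : ∀ i → InArray (shape F) i (i ℤ.- + 1)
    p₁ i = inArray (shape F) 1 (row-mono (shape F) (s≤s z≤n) (row-two (shape F))) (e₁ i)

    g-unimodular : ∀ i t → Row (shape F) (2 ℕ.+ t) →
      rows m i (1 ℕ.+ t) * rows m (i ℤ.+ + 1) (1 ℕ.+ t) - rows m i (2 ℕ.+ t) * rows m (i ℤ.+ + 1) t ≃ 1ℝ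
    g-unimodular i t row = R.trans
      (R.sym (R.+-cong
        (R.*-cong (entry≃rows (1 ℕ.+ t) p refl refl) (entry≃rows (1 ℕ.+ t) q refl eq-q))
        (R.-‿cong (R.*-cong (entry≃rows (2 ℕ.+ t) r refl eq-r) (entry≃rows t s refl eq-s)))))
      (unimodular F i j p q r s)
      where
      j = i ℤ.+ + (1 ℕ.+ t) ℤ.- + 2
      eq-q : j ℤ.+ + 1 ≡ i ℤ.+ + 1 ℤ.+ + (1 ℕ.+ t) ℤ.- + 2
      eq-q = solveᶻ 2 (λ i t → i ⊕ t ⊖ κ (+ 2) ⊕ κ (+ 1) ⊜ i ⊕ κ (+ 1) ⊕ t ⊖ κ (+ 2)) refl i (+ (1 ℕ.+ t))
      eq-r : j ℤ.+ + 1 ≡ i ℤ.+ + (2 ℕ.+ t) ℤ.- + 2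
      eq-r = solveᶻ 2 (λ i t → i ⊕ t ⊖ κ (+ 2) ⊕ κ (+ 1) ⊜ i ⊕ (κ (+ 1) ⊕ t) ⊖ κ (+ 2)) refl i (+ (1 ℕ.+ t))
      eq-s : j ≡ i ℤ.+ + 1 ℤ.+ + t ℤ.- + 2
      eq-s = cong (ℤ._- + 2) (sym (ℤₚ.+-assoc i (+ 1) (+ t)))
      row₁ = row-mono (shape F) (ℕₚ.n≤1+n (1 ℕ.+ t)) row
      p : InArray (shape F) i j
      p = inArray (shape F) (1 ℕ.+ t) row₁ refl
      q : InArray (shape F) (i ℤ.+ + 1) (j ℤ.+ + 1)
      q = inArray (shape F) (1 ℕ.+ t) row₁ eq-q
      r : InArray (shape F) i (j ℤ.+ + 1)
      r = inArray (shape F) (2 ℕ.+ t) row eq-r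
      s : InArray (shape F) (i ℤ.+ + 1) j
      s = inArray (shape F) t (row-mono (shape F) (ℕₚ.n≤1+n t) row₁) eq-s

    g-tame : ∀ i t → Row (shape F) (4 ℕ.+ t) →
      det₃ (λ r c → rows m (columns i c) (toℕ r ℕ.+ (2 ∸ toℕ c) ℕ.+ t)) ≃ 0ℝ
    g-tame i t row = R.trans
      (R.sym (det₃-cong
        (λ r c → entry F (i ℤ.+ + toℕ c) (i ℤ.+ + t ℤ.+ + toℕ r) (p r c))
        (λ r c → rows m (columns i c) (toℕ r ℕ.+ (2 ∸ toℕ c) ℕ.+ t))
        (λ r c → entry≃rows (toℕ r ℕ.+ (2 ∸ toℕ c) ℕ.+ t) (p r c) (column i c)
          (trans (position r c) (cong (λ k → k ℤ.+ + (toℕ r ℕ.+ (2 ∸ toℕ c) ℕ.+ t) ℤ.- + 2) (sym (column i c)))))))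
      (tame i (i ℤ.+ + t) p)
      where
      column : ∀ i c → columns i c ≡ i ℤ.+ + toℕ c
      column i 0F = sym (ℤₚ.+-identityʳ i)
      column i 1F = refl
      column i 2F = ℤₚ.+-assoc i (+ 1) (+ 1)
      position : ∀ (r c : Fin 3) → i ℤ.+ + t ℤ.+ + toℕ r ≡ i ℤ.+ + toℕ c ℤ.+ + (toℕ r ℕ.+ (2 ∸ toℕ c) ℕ.+ t) ℤ.- + 2
      position r 0F = solveᶻ 3 (λ i r t → i ⊕ t ⊕ r ⊜ i ⊕ κ (+ 0) ⊕ (r ⊕ κ (+ 2) ⊕ t) ⊖ κ (+ 2)) refl i (+ toℕ r) (+ t)
      position r 1F = solveᶻ 3 (λ i r t → i ⊕ t ⊕ r ⊜ i ⊕ κ (+ 1) ⊕ (r ⊕ κ (+ 1) ⊕ t) ⊖ κ (+ 2)) refl i (+ toℕ r) (+ t)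
      position r 2F = solveᶻ 3 (λ i r t → i ⊕ t ⊕ r ⊜ i ⊕ κ (+ 2) ⊕ (r ⊕ κ (+ 0) ⊕ t) ⊖ κ (+ 2)) refl i (+ toℕ r) (+ t)
      p : ∀ (r c : Fin 3) → InArray (shape F) (i ℤ.+ + toℕ c) (i ℤ.+ + t ℤ.+ + toℕ r)
      p r c = inArray (shape F) (toℕ r ℕ.+ (2 ∸ toℕ c) ℕ.+ t)
        (row-mono (shape F) (ℕₚ.+-monoˡ-≤ t (ℕₚ.+-mono-≤ (Finₚ.toℕ≤pred[n] r) (ℕₚ.m∸n≤m 2 (toℕ c)))) row)
        (position r c)

  open Grid grid public

-- In an infinite frieze every row number lies in the array. In a finite one, matching on the bound
-- exposes the width as `2 + M`.
lattice-recurrence : ∀ F (tame : Tame F) m (lat : IsLattice F m) → ∀ t → Lattice.Recurrence F tame m lat t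
lattice-recurrence F@record{ shape = infinite } tame m lat t = Lattice.recurrence F tame m lat t tt
lattice-recurrence F@record{ shape = finite (suc (suc M)) (s≤s (s≤s _)) } tame m lat =
  FiniteGrid.lattice-recurrence grid
    (λ i → R.trans (R.sym (entry≃rows (1 ℕ.+ M) (p₁ i) refl (e₁ i))) (proj₁ (end F) i (p₁ i)))
    (λ i → R.trans (R.sym (entry≃rows (2 ℕ.+ M) (p₂ i) refl refl)) (proj₂ (end F) i (p₂ i)))
    reflect translate
  where
  open Lattice F tame m lat
  N = 2 ℕ.+ M
  e₁ : ∀ i → i ℤ.+ + N ℤ.- + 3 ≡ i ℤ.+ + (1 ℕ.+ M) ℤ.- + 2
  e₁ i = solveᶻ 2 (λ i M → i ⊕ (κ (+ 2) ⊕ M) ⊖ κ (+ 3) ⊜ i ⊕ (κ (+ 1) ⊕ M) ⊖ κ (+ 2)) refl i (+ M)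
  p₁ : ∀ i → InArray (shape F) i (i ℤ.+ + N ℤ.- + 3)
  p₁ i = inArray (shape F) {i} (1 ℕ.+ M) (ℕₚ.n≤1+n (1 ℕ.+ M)) (e₁ i)
  p₂ : ∀ i → InArray (shape F) i (i ℤ.+ + N ℤ.- + 2)
  p₂ i = inArray (shape F) {i} (2 ℕ.+ M) ℕₚ.≤-refl refl

  reflect : ∀ i t u → t ℕ.+ u ≡ N → rows m i (N ℕ.+ t) ≃ - rows m (i ℤ.+ + t) u
  reflect i t u t+u≡N = R.trans
    (proj₂ (mirrored lat) i (i ℤ.+ + (N ℕ.+ t) ℤ.- + 2))
    (R.reflexive (cong₂ (λ k l → - m k l)
      (solveᶻ 3 (λ i N t → i ⊕ (N ⊕ t) ⊖ κ (+ 2) ⊖ N ⊕ κ (+ 2) ⊜ i ⊕ t) refl i (+ N) (+ t))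
      (trans (cong (λ n → i ℤ.+ + n ℤ.- + 2) (sym t+u≡N))
             (cong (ℤ._- + 2) (sym (ℤₚ.+-assoc i (+ t) (+ u)))))))

  -- The two mirrors in succession form a translation, and their signs cancel.
  translate : ∀ i t → rows m i (N ℕ.+ (N ℕ.+ t)) ≃ rows m (i ℤ.+ + N) t
  translate i t = begin
    m i j
      ≈⟨ proj₂ (mirrored lat) i j ⟩
    - m (j ℤ.- + N ℤ.+ + 2) (i ℤ.+ + N ℤ.- + 2)
      ≈⟨ R.-‿cong (proj₁ (mirrored lat) (j ℤ.- + N ℤ.+ + 2) (i ℤ.+ + N ℤ.- + 2)) ⟩
    - - m (i ℤ.+ + N ℤ.- + 2 ℤ.+ + 2) (j ℤ.- + N ℤ.+ + 2 ℤ.- + 2)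
      ≡⟨ cong₂ (λ k l → - - m k l)
           (solveᶻ 2 (λ i N → i ⊕ N ⊖ κ (+ 2) ⊕ κ (+ 2) ⊜ i ⊕ N) refl i (+ N))
           (solveᶻ 3 (λ i N t → i ⊕ (N ⊕ (N ⊕ t)) ⊖ κ (+ 2) ⊖ N ⊕ κ (+ 2) ⊖ κ (+ 2) ⊜ i ⊕ N ⊕ t ⊖ κ (+ 2)) refl i (+ N) (+ t)) ⟩
    - - rows m (i ℤ.+ + N) t
      ≈⟨ solve 1 (λ x → :- (:- x) := x) R.refl (rows m (i ℤ.+ + N) t) ⟩
    rows m (i ℤ.+ + N) t ∎
    where
    open ≃-Reasoning
    j = i ℤ.+ + (N ℕ.+ (N ℕ.+ t)) ℤ.- + 2

-- Reaches the row just below the array, where `y 0` lies.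
mirror-first : ∀ {F m} → IsLattice F m → ∀ i → m i (i ℤ.- + 3) ≃ - m (i ℤ.- + 1) (i ℤ.- + 2)
mirror-first {F} {m} lat i = R.trans (mirror (shape F) (mirrored lat))
  (R.reflexive (cong (λ k → - m k (i ℤ.- + 2))
    (solveᶻ 1 (λ i → i ⊖ κ (+ 3) ⊕ κ (+ 2) ⊜ i ⊖ κ (+ 1)) refl i)))
  where
  mirror : ∀ σ → Mirrored σ m → m i (i ℤ.- + 3) ≃ - m (i ℤ.- + 3 ℤ.+ + 2) (i ℤ.- + 2)
  mirror infinite     M = M i (i ℤ.- + 3) (subst (ℤ._< ℤ.- + 2)
    (solveᶻ 1 (λ i → ⊖ κ (+ 3) ⊜ i ⊖ κ (+ 3) ⊖ i) refl i) (ℤ.-<- (s≤s (s≤s z≤n))))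
  mirror (finite _ _) M = proj₁ M i (i ℤ.- + 3)

-- Growth coefficients as traces of monodromy powers.

module Growth (F : Frieze) (tame : Tame F) (n : ℕ) (period : Periodic F n)
  (m : ℤ → ℤ → ℝ) (lat : IsLattice F m) where

  open Lattice F tame m lat

  -- Both solutions are read at the same second index `t - 1`, so that they share the coefficient
  -- `b t`; `y` therefore starts one row below the array.
  x y b : ℕ → ℝ
  x t = m (+ 1) (+ t ℤ.- + 1)
  y t = m (+ 2) (+ t ℤ.- + 1)
  b t = quiddity (+ (1 ℕ.+ t))

  x-rows : ∀ t → x t ≡ rows m (+ 1) t
  x-rows t = cong (m (+ 1)) (solveᶻ 1 (λ t → t ⊖ κ (+ 1) ⊜ κ (+ 1) ⊕ t ⊖ κ (+ 2)) refl (+ t))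

  y-rows : ∀ t → y (1 ℕ.+ t) ≡ rows m (+ 2) t
  y-rows t = cong (m (+ 2)) (solveᶻ 1 (λ t → κ (+ 1) ⊕ t ⊖ κ (+ 1) ⊜ κ (+ 2) ⊕ t ⊖ κ (+ 2)) refl (+ t))

  x₀ : x 0 ≃ 0ℝ
  x₀ = g-zero (+ 1)

  x₁ : x 1 ≃ 1ℝ
  x₁ = g-one (+ 1)

  y₀ : y 0 ≃ - 1ℝ
  y₀ = R.trans (mirror-first lat (+ 2)) (R.-‿cong x₁)

  y₁ : y 1 ≃ 0ℝ
  y₁ = g-zero (+ 2)

  x-solves : Solves b x
  x-solves t = begin
    x (2 ℕ.+ t)                                            ≡⟨ x-rows (2 ℕ.+ t) ⟩
    rows m (+ 1) (2 ℕ.+ t)                                 ≈⟨ lattice-recurrence F tame m lat t (+ 1) ⟩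
    b t * rows m (+ 1) (1 ℕ.+ t) - rows m (+ 1) t          ≡⟨ cong₂ (λ u v → b t * u - v) (x-rows (1 ℕ.+ t)) (x-rows t) ⟨
    b t * x (1 ℕ.+ t) - x t                                ∎
    where open ≃-Reasoning

  y-solves : Solves b y
  -- The values -1, 0, 1 straddle the mirror, so the array's own recurrence does not cover this
  -- step.
  y-solves zero = begin
    y 2                     ≈⟨ g-one (+ 2) ⟩
    1ℝ                      ≈⟨ solve 1 (λ b → con 1ℚ := b :* con 0ℚ :- (:- con 1ℚ)) R.refl (b 0) ⟩
    b 0 * 0ℝ - - 1ℝ         ≈⟨ R.+-cong (R.*-congˡ y₁) (R.-‿cong y₀) ⟨
    b 0 * y 1 - y 0         ∎
    where open ≃-Reasoning
  y-solves (suc t) = begin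
    y (3 ℕ.+ t)                                            ≡⟨ y-rows (2 ℕ.+ t) ⟩
    rows m (+ 2) (2 ℕ.+ t)                                 ≈⟨ lattice-recurrence F tame m lat t (+ 2) ⟩
    b (1 ℕ.+ t) * rows m (+ 2) (1 ℕ.+ t) - rows m (+ 2) t  ≡⟨ cong₂ (λ u v → b (1 ℕ.+ t) * u - v) (y-rows (1 ℕ.+ t)) (y-rows t) ⟨
    b (1 ℕ.+ t) * y (2 ℕ.+ t) - y (1 ℕ.+ t)                ∎
    where open ≃-Reasoning

  quiddity-n-periodic : ∀ i → quiddity (i ℤ.+ + n) ≃ quiddity i
  quiddity-n-periodic i = begin
    quiddity (i ℤ.+ + n)                      ≈⟨ entry≃rows 2 p refl eq ⟨
    entry F (i ℤ.+ + n) (j ℤ.+ + n) p         ≈⟨ proj₂ period i j p q ⟩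
    entry F i j q                             ≈⟨ entry≃rows 2 q refl refl ⟩
    quiddity i                                ∎
    where
    open ≃-Reasoning
    j = i ℤ.+ + 2 ℤ.- + 2
    eq : j ℤ.+ + n ≡ i ℤ.+ + n ℤ.+ + 2 ℤ.- + 2
    eq = solveᶻ 2 (λ i n → i ⊕ κ (+ 2) ⊖ κ (+ 2) ⊕ n ⊜ i ⊕ n ⊕ κ (+ 2) ⊖ κ (+ 2)) refl i (+ n)
    q : InArray (shape F) i j
    q = inArray (shape F) 2 (row-two (shape F)) refl
    p : InArray (shape F) (i ℤ.+ + n) (j ℤ.+ + n)
    p = inArray (shape F) 2 (row-two (shape F)) eq

  open Monodromy b n (λ t → quiddity-n-periodic (+ (1 ℕ.+ t))) x y x-solves y-solves x₀ x₁ y₀ y₁ public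

  -- The convention `s 0 = 2` is the trace of the identity matrix; for positive `k` both sides agree
  -- by computation.
  growth≃trace : ∀ k → growth m n k ≃ trace k
  growth≃trace zero    = R.sym trace-zero
  growth≃trace (suc k) = R.refl

  growth-recurrence : ∀ k → growth m n (2 ℕ.+ k) ≃ growth m n 1 * growth m n (1 ℕ.+ k) - growth m n k
  growth-recurrence k = R.trans (trace-recurrence k) (R.+-congˡ (R.-‿cong (R.sym (growth≃trace k))))

proposition2p10 : (F : Frieze) → Tame F →
    (n : ℕ) → MinimalPeriod F n →
    (m : ℤ → ℤ → ℝ) → IsLattice F m →
    let s = growth m n in
    ((k : ℕ) → s (2 ℕ.+ k) ≃ s 1 * s (1 ℕ.+ k) - s k) ×
    ((k : ℕ) → 1 ≤ k →
    s k ≃ s 1 ^ k + fromℕ k * sum {⌊ k /2⌋} (λ i →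
    let l = suc (toℕ i) in
    (- 1ℝ) ^ l * fromℚ (_/_ (+ 1) (k ∸ l) {{k∸l-nonZero k i}})
    * fromℕ ((k ∸ l) C l) * s 1 ^ (k ∸ 2 ℕ.* l)))
proposition2p10 F tame n (period , _) m lat =
  growth-recurrence , closed-form s R.refl R.refl growth-recurrence
  where
  open Growth F tame n period m lat
  s = growth m n
  open Chebyshev (s 1)
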